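{- Let $n\ge 2$ be an integer. Then $$\ker\mathcal{D}_{\mathcal{K}_1}=\mathbb{Q}[x_0,C_2,C_3,\ldots,C_n][x_0^{ -1}]\cap\mathbb{Q}[x_0,x_1,\ldots,x_n],$$ where $\mathcal{D}_{\mathcal{K}_1}$ is the first Kravchuk derivation of $\mathbb{Q}[x_0,x_1,\ldots,x_n]$, $C_2,\ldots,C_n$ are its Cayley elements, and the intersection is taken inside $\mathbb{Q}[x_0,x_1,\ldots,x_n][x_0^{ -1}]$.
   Context: A derivation of $\mathbb{Q}[x_0,\ldots,x_n]$ is a $\mathbb{Q}$-linear map $D$ satisfying the Leibniz rule; it is determined by the values $D(x_m)$. Its kernel is $\ker D=\{f\in\mathbb{Q}[x_0,\ldots,x_n]: D(f)=0\}$. The first Kravchuk derivation $\mathcal{D}_{\mathcal{K}_1}$ is the derivation of $\mathbb{Q}[x_0,\ldots,x_n]$ with $$\mathcal{D}_{\mathcal{K}_1}(x_0)=0,\qquad \mathcal{D}_{\mathcal{K}_1}(x_m)=\sum_{i=1}^{m}\frac{1-(-1)^i}{2i}\,x_{m-i}\quad(1\le m\le n).$$ It is triangular, hence locally nilpotent. For $0\le m\le n$ put $$\sigma(x_m)=\sum_{k=0}^{\infty}\mathcal{D}_{\mathcal{K}_1}^k(x_m)\frac{\lambda^k}{k!},\qquad \lambda=-\frac{x_1}{x_0}$$ (a finite sum, lying in $\mathbb{Q}[x_0,\ldots,x_n][x_0^{ -1}]$). The Cayley elements are $$C_m:=m\,(m-2)!\,x_0^{m-1}\sigma(x_m)\in\mathbb{Q}[x_0,\ldots,x_n],\qquad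 2\le m\le n;$$ for example $C_2=2x_2x_0-x_1^2$ and $C_3=3x_3x_0^2-x_1x_0^2-3x_1x_0x_2+x_1^3$. -}

module Defs where

open import Algebra.Bundles using (CommutativeRing)
open import Algebra.Morphism.Structures using (module RingMorphisms)
open import Algebra.Morphism.Construct.Identity
  using () renaming (isRingHomomorphism to idIsRingHomomorphism)
open import Data.Fin.Base using (Fin; zero; suc; toℕ; fromℕ<; inject; opposite)
open import Data.Fin.Properties using (toℕ<n; toℕ-inject)
open import Data.Integer.Base as ℤ using (1ℤ; -1ℤ; +_)
open import Data.Nat.Base as ℕ using (ℕ; zero; suc; z≤n; s≤s; _∸_; _!)
import Data.Nat.Properties as ℕ
open import Data.Nat.GeneralisedArithmetic using (iterate)
open import Data.Product.Base using (∃-syntax; _×_; _,_)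
open import Data.Rational.Base as ℚ using (ℚ; 0ℚ; 1ℚ)
import Data.Rational.Properties as ℚ
open import Level using (Level; _⊔_; 0ℓ)
open import Relation.Binary.PropositionalEquality.Core as ≡ using (_≡_)
open import Relation.Unary using (Pred; _∈_; _∪_; ｛_｝; U)
import Relation.Binary.Reasoning.Setoid as SetoidReasoning
import Algebra.Properties.CommutativeMonoid.Sum as SumProperties
import Algebra.Properties.Ring as RingProperties
import Algebra.Properties.Semiring.Exp as Exp
import Algebra.Solver.Ring.NaturalCoefficients.Default as SemiringSolver

------------------------------------------------------------------------
-- Polynomial rings over ℚ

-- ℚ[x₀,…,x_{N-1}] is the free commutative ℚ-algebra on Fin N: polynomial
-- expressions modulo the congruence _≈_ generated by the axioms of a
-- commutative ring and by con being a ring homomorphism from ℚ.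
-- Its universal property is eval-isRingHomomorphism below.

infixl 6 _:+_
infixl 7 _:*_

data Poly (N : ℕ) : Set where
  con  : ℚ → Poly N
  var  : Fin N → Poly N
  _:+_ : Poly N → Poly N → Poly N
  _:*_ : Poly N → Poly N → Poly N

infix 4 _≈_

data _≈_ {N : ℕ} : Poly N → Poly N → Set where
  refl        : ∀ {f} → f ≈ f
  sym         : ∀ {f g} → f ≈ g → g ≈ f
  trans       : ∀ {f g h} → f ≈ g → g ≈ h → f ≈ h
  +-cong      : ∀ {f f′ g g′} → f ≈ f′ → g ≈ g′ → f :+ g ≈ f′ :+ g′
  *-cong      : ∀ {f f′ g g′} → f ≈ f′ → g ≈ g′ → f :* g ≈ f′ :* g′
  +-assoc     : ∀ f g h → (f :+ g) :+ h ≈ f :+ (g :+ h)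
  +-comm      : ∀ f g → f :+ g ≈ g :+ f
  +-identityˡ : ∀ f → con 0ℚ :+ f ≈ f
  *-assoc     : ∀ f g h → (f :* g) :* h ≈ f :* (g :* h)
  *-comm      : ∀ f g → f :* g ≈ g :* f
  *-identityˡ : ∀ f → con 1ℚ :* f ≈ f
  distribˡ    : ∀ f g h → f :* (g :+ h) ≈ f :* g :+ f :* h
  zeroˡ       : ∀ f → con 0ℚ :* f ≈ con 0ℚ
  con-+       : ∀ p q → con (p ℚ.+ q) ≈ con p :+ con q
  con-*       : ∀ p q → con (p ℚ.* q) ≈ con p :* con q

infix 8 :-_

:-_ : ∀ {N} → Poly N → Poly N
:- f = con (ℚ.- 1ℚ) :* f

private
  module _ {N : ℕ} where

    +-inverseˡ : (f : Poly N) → :- f :+ f ≈ con 0ℚ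
    +-inverseˡ f =
      trans (+-cong (*-comm _ f) (trans (sym (*-identityˡ f)) (*-comm _ f)))
      (trans (sym (distribˡ f (con (ℚ.- 1ℚ)) (con 1ℚ)))
      (trans (*-comm f _)
      (trans (*-cong (sym (con-+ (ℚ.- 1ℚ) 1ℚ)) refl) (zeroˡ f))))

    distribʳ : (f g h : Poly N) → (g :+ h) :* f ≈ g :* f :+ h :* f
    distribʳ f g h = trans (*-comm _ f)
      (trans (distribˡ f g h) (+-cong (*-comm f g) (*-comm f h)))

polyRing : ℕ → CommutativeRing 0ℓ 0ℓ
polyRing N = record
  { Carrier = Poly N
  ; _≈_ = _≈_
  ; _+_ = _:+_
  ; _*_ = _:*_
  ; -_ = :-_
  ; 0# = con 0ℚ
  ; 1# = con 1ℚ
  ; isCommutativeRing = record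
    { isRing = record
      { +-isAbelianGroup = record
        { isGroup = record
          { isMonoid = record
            { isSemigroup = record
              { isMagma = record
                { isEquivalence = record { refl = refl ; sym = sym ; trans = trans }
                ; ∙-cong = +-cong
                }
              ; assoc = +-assoc
              }
            ; identity = +-identityˡ , λ f → trans (+-comm f _) (+-identityˡ f)
            }
          ; inverse = +-inverseˡ , λ f → trans (+-comm f _) (+-inverseˡ f)
          ; ⁻¹-cong = *-cong refl
          }
        ; comm = +-comm
        }
      ; *-cong = *-cong
      ; *-assoc = *-assoc
      ; *-identity = *-identityˡ , λ f → trans (*-comm f _) (*-identityˡ f)
      ; distrib = distribˡ , distribʳ
      }
    ; *-comm = *-comm
    }
  }

module Evaluation {c ℓ : Level} (R : CommutativeRing c ℓ)
                  {φ : ℚ → CommutativeRing.Carrier R}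
                  (φ-hom : RingMorphisms.IsRingHomomorphism
                             ℚ.+-*-rawRing (CommutativeRing.rawRing R) φ) where

  private
    module R = CommutativeRing R
    module φ = RingMorphisms.IsRingHomomorphism φ-hom

  eval : ∀ {N} → (Fin N → R.Carrier) → Poly N → R.Carrier
  eval ρ (con q)  = φ q
  eval ρ (var i)  = ρ i
  eval ρ (f :+ g) = eval ρ f R.+ eval ρ g
  eval ρ (f :* g) = eval ρ f R.* eval ρ g

  module _ {N : ℕ} (ρ : Fin N → R.Carrier) where

    eval-cong : ∀ {f g} → f ≈ g → eval ρ f R.≈ eval ρ g
    eval-cong refl            = R.refl
    eval-cong (sym p)         = R.sym (eval-cong p)
    eval-cong (trans p q)     = R.trans (eval-cong p) (eval-cong q)
    eval-cong (+-cong p q)    = R.+-cong (eval-cong p) (eval-cong q)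
    eval-cong (*-cong p q)    = R.*-cong (eval-cong p) (eval-cong q)
    eval-cong (+-assoc f g h) = R.+-assoc _ _ _
    eval-cong (+-comm f g)    = R.+-comm _ _
    eval-cong (+-identityˡ f) = R.trans (R.+-congʳ φ.0#-homo) (R.+-identityˡ _)
    eval-cong (*-assoc f g h) = R.*-assoc _ _ _
    eval-cong (*-comm f g)    = R.*-comm _ _
    eval-cong (*-identityˡ f) = R.trans (R.*-congʳ φ.1#-homo) (R.*-identityˡ _)
    eval-cong (distribˡ f g h) = R.distribˡ _ _ _
    eval-cong (zeroˡ f)       =
      R.trans (R.*-congʳ φ.0#-homo) (R.trans (R.zeroˡ _) (R.sym φ.0#-homo))
    eval-cong (con-+ p q)     = φ.+-homo p q
    eval-cong (con-* p q)     = φ.*-homo p q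

    eval-isRingHomomorphism : RingMorphisms.IsRingHomomorphism
      (CommutativeRing.rawRing (polyRing N)) R.rawRing (eval ρ)
    eval-isRingHomomorphism = record
      { isSemiringHomomorphism = record
        { isNearSemiringHomomorphism = record
          { +-isMonoidHomomorphism = record
            { isMagmaHomomorphism = record
              { isRelHomomorphism = record { cong = eval-cong }
              ; homo = λ _ _ → R.refl
              }
            ; ε-homo = φ.0#-homo
            }
          ; *-homo = λ _ _ → R.refl
          }
        ; 1#-homo = φ.1#-homo
        }
      ; -‿homo = λ f → R.trans
          (R.*-congʳ (R.trans (φ.-‿homo 1ℚ) (R.-‿cong φ.1#-homo)))
          (-1*x≈-x (eval ρ f))
      }
      where open RingProperties R.ring using (-1*x≈-x)

con-isRingHomomorphism : ∀ {N} → RingMorphisms.IsRingHomomorphism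
  ℚ.+-*-rawRing (CommutativeRing.rawRing (polyRing N)) con
con-isRingHomomorphism = record
  { isSemiringHomomorphism = record
    { isNearSemiringHomomorphism = record
      { +-isMonoidHomomorphism = record
        { isMagmaHomomorphism = record
          { isRelHomomorphism = record { cong = λ { ≡.refl → refl } }
          ; homo = con-+
          }
        ; ε-homo = refl
        }
      ; *-homo = con-*
      }
    ; 1#-homo = refl
    }
  ; -‿homo = λ q → trans
      (≡.subst (λ r → con r ≈ con (ℚ.- 1ℚ ℚ.* q)) (-1*x≈-x q) refl)
      (con-* (ℚ.- 1ℚ) q)
  }
  where
  open RingProperties (CommutativeRing.ring ℚ.+-*-commutativeRing) using (-1*x≈-x)

con-injective : ∀ {N} {p q : ℚ} → con {N} p ≈ con q → p ≡ q
con-injective = eval-cong (λ _ → 0ℚ)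
  where
  open Evaluation ℚ.+-*-commutativeRing
         (idIsRingHomomorphism ℚ.+-*-rawRing ≡.refl)

module _ {N : ℕ} where

  private
    module P = CommutativeRing (polyRing (suc N))
    open SetoidReasoning P.setoid
    open SemiringSolver P.commutativeSemiring
      using (solve) renaming (_:=_ to _⊜_; _:+_ to _⊕_; _:*_ to _⊗_)
    open Evaluation (polyRing (suc N)) con-isRingHomomorphism

    X : Poly (suc N)
    X = var zero

    ρ : Fin (suc N) → Poly (suc N)
    ρ zero    = con 0ℚ
    ρ (suc i) = var (suc i)

    at0 : Poly (suc N) → Poly (suc N)
    at0 = eval ρ

    -- The quotient of f by x₀, with remainder at0 f.
    quo : Poly (suc N) → Poly (suc N)
    quo (con q)       = con 0ℚ
    quo (var zero)    = con 1ℚ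
    quo (var (suc i)) = con 0ℚ
    quo (f :+ g)      = quo f :+ quo g
    quo (f :* g)      = quo f :* g :+ at0 f :* quo g

    f+X*0≈f : ∀ f → f ≈ f :+ X :* con 0ℚ
    f+X*0≈f f = sym (trans (+-cong refl (P.zeroʳ X)) (P.+-identityʳ f))

    at0+X*quo : ∀ f → f ≈ at0 f :+ X :* quo f
    at0+X*quo (con q)       = f+X*0≈f _
    at0+X*quo (var zero)    = sym (trans (+-identityˡ _) (P.*-identityʳ X))
    at0+X*quo (var (suc i)) = f+X*0≈f _
    at0+X*quo (f :+ g)      = trans (+-cong (at0+X*quo f) (at0+X*quo g))
      (solve 5 (λ x a b c d →
         ((a ⊕ x ⊗ b) ⊕ (c ⊕ x ⊗ d)) ⊜ ((a ⊕ c) ⊕ x ⊗ (b ⊕ d)))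
         refl X (at0 f) (quo f) (at0 g) (quo g))
    at0+X*quo (f :* g)      = begin
      f :* g
        ≈⟨ *-cong (at0+X*quo f) refl ⟩
      (at0 f :+ X :* quo f) :* g
        ≈⟨ P.distribʳ _ _ _ ⟩
      at0 f :* g :+ X :* quo f :* g
        ≈⟨ +-cong (*-cong refl (at0+X*quo g)) refl ⟩
      at0 f :* (at0 g :+ X :* quo g) :+ X :* quo f :* g
        ≈⟨ solve 6 (λ x a b c d e →
             (a ⊗ (c ⊕ x ⊗ d) ⊕ x ⊗ b ⊗ e) ⊜ (a ⊗ c ⊕ x ⊗ (b ⊗ e ⊕ a ⊗ d)))
             refl X (at0 f) (quo f) (at0 g) (quo g) g ⟩
      at0 f :* at0 g :+ X :* (quo f :* g :+ at0 f :* quo g) ∎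

    quo-cong : ∀ {f g} → f ≈ g → quo f ≈ quo g
    quo-cong refl            = refl
    quo-cong (sym p)         = sym (quo-cong p)
    quo-cong (trans p q)     = trans (quo-cong p) (quo-cong q)
    quo-cong (+-cong p q)    = +-cong (quo-cong p) (quo-cong q)
    quo-cong (*-cong p q)    =
      +-cong (*-cong (quo-cong p) q) (*-cong (eval-cong ρ p) (quo-cong q))
    quo-cong (+-assoc f g h) = +-assoc _ _ _
    quo-cong (+-comm f g)    = +-comm _ _
    quo-cong (+-identityˡ f) = +-identityˡ _
    quo-cong (*-assoc f g h) = solve 7
      (λ f′ g h f₀ g′ g₀ h′ →
        ((f′ ⊗ g ⊕ f₀ ⊗ g′) ⊗ h ⊕ (f₀ ⊗ g₀) ⊗ h′)
        ⊜ (f′ ⊗ (g ⊗ h) ⊕ f₀ ⊗ (g′ ⊗ h ⊕ g₀ ⊗ h′)))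
      refl (quo f) g h (at0 f) (quo g) (at0 g) (quo h)
    quo-cong (*-comm f g)    = begin
      quo f :* g :+ at0 f :* quo g
        ≈⟨ +-cong (*-cong refl (at0+X*quo g)) refl ⟩
      quo f :* (at0 g :+ X :* quo g) :+ at0 f :* quo g
        ≈⟨ solve 5 (λ x a b c d →
             (b ⊗ (c ⊕ x ⊗ d) ⊕ a ⊗ d) ⊜ (d ⊗ (a ⊕ x ⊗ b) ⊕ c ⊗ b))
             refl X (at0 f) (quo f) (at0 g) (quo g) ⟩
      quo g :* (at0 f :+ X :* quo f) :+ at0 g :* quo f
        ≈⟨ +-cong (*-cong refl (at0+X*quo f)) refl ⟨
      quo g :* f :+ at0 g :* quo f ∎
    quo-cong (*-identityˡ f) =
      trans (+-cong (zeroˡ f) (*-identityˡ _)) (+-identityˡ _)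
    quo-cong (distribˡ f g h) = solve 6
      (λ f₀ f′ g g′ h h′ →
        (f′ ⊗ (g ⊕ h) ⊕ f₀ ⊗ (g′ ⊕ h′))
        ⊜ ((f′ ⊗ g ⊕ f₀ ⊗ g′) ⊕ (f′ ⊗ h ⊕ f₀ ⊗ h′)))
      refl (at0 f) (quo f) g (quo g) h (quo h)
    quo-cong (zeroˡ f)       =
      trans (+-cong (zeroˡ f) (zeroˡ _)) (+-identityˡ _)
    quo-cong (con-+ p q)     = sym (+-identityˡ _)
    quo-cong (con-* p q)     =
      sym (trans (+-cong (zeroˡ _) (P.zeroʳ _)) (+-identityˡ _))

    quo-X* : ∀ f → quo (X :* f) ≈ f
    quo-X* f = trans (+-cong (*-identityˡ f) (zeroˡ _)) (P.+-identityʳ f)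

  x₀-cancelˡ : ∀ {f g} → X :* f ≈ X :* g → f ≈ g
  x₀-cancelˡ {f} {g} p = trans (sym (quo-X* f)) (trans (quo-cong p) (quo-X* g))

------------------------------------------------------------------------
-- Derivations of polynomial rings

record IsDerivation {N : ℕ} (D : Poly N → Poly N) : Set where
  field
    cong    : ∀ {f g} → f ≈ g → D f ≈ D g
    +-homo  : ∀ f g → D (f :+ g) ≈ D f :+ D g
    scale   : ∀ q f → D (con q :* f) ≈ con q :* D f
    leibniz : ∀ f g → D (f :* g) ≈ D f :* g :+ f :* D g

derivation : ∀ {N} → (Fin N → Poly N) → Poly N → Poly N
derivation d (con q)  = con 0ℚ
derivation d (var i)  = d i
derivation d (f :+ g) = derivation d f :+ derivation d g
derivation d (f :* g) = derivation d f :* g :+ f :* derivation d g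

module _ {N : ℕ} where

  private
    module P = CommutativeRing (polyRing N)
    open SetoidReasoning P.setoid
    open SemiringSolver P.commutativeSemiring
      using (solve) renaming (_:=_ to _⊜_; _:+_ to _⊕_; _:*_ to _⊗_)
    0p : Poly N
    0p = con 0ℚ

  derivation-isDerivation : (d : Fin N → Poly N) → IsDerivation (derivation d)
  derivation-isDerivation d = record
    { cong = D-cong
    ; +-homo = λ _ _ → refl
    ; scale = λ q f → trans (+-cong (zeroˡ f) refl) (+-identityˡ _)
    ; leibniz = λ _ _ → refl
    }
    where
    D : Poly N → Poly N
    D = derivation d
    D-cong : ∀ {f g} → f ≈ g → D f ≈ D g
    D-cong refl            = refl
    D-cong (sym p)         = sym (D-cong p)
    D-cong (trans p q)     = trans (D-cong p) (D-cong q)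
    D-cong (+-cong p q)    = +-cong (D-cong p) (D-cong q)
    D-cong (*-cong p q)    = +-cong (*-cong (D-cong p) q) (*-cong p (D-cong q))
    D-cong (+-assoc f g h) = +-assoc _ _ _
    D-cong (+-comm f g)    = +-comm _ _
    D-cong (+-identityˡ f) = +-identityˡ _
    D-cong (*-assoc f g h) = solve 6
      (λ f g h f′ g′ h′ →
        ((f′ ⊗ g ⊕ f ⊗ g′) ⊗ h ⊕ (f ⊗ g) ⊗ h′)
        ⊜ (f′ ⊗ (g ⊗ h) ⊕ f ⊗ (g′ ⊗ h ⊕ g ⊗ h′)))
      refl f g h (D f) (D g) (D h)
    D-cong (*-comm f g)    = trans (+-comm _ _) (+-cong (*-comm _ _) (*-comm _ _))
    D-cong (*-identityˡ f) =
      trans (+-cong (zeroˡ f) (*-identityˡ _)) (+-identityˡ _)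
    D-cong (distribˡ f g h) = solve 6
      (λ f g h f′ g′ h′ →
        (f′ ⊗ (g ⊕ h) ⊕ f ⊗ (g′ ⊕ h′))
        ⊜ ((f′ ⊗ g ⊕ f ⊗ g′) ⊕ (f′ ⊗ h ⊕ f ⊗ h′)))
      refl f g h (D f) (D g) (D h)
    D-cong (zeroˡ f)       =
      trans (+-cong (zeroˡ f) (zeroˡ _)) (+-identityˡ _)
    D-cong (con-+ p q)     = sym (+-identityˡ _)
    D-cong (con-* p q)     =
      sym (trans (+-cong (zeroˡ _) (P.zeroʳ _)) (+-identityˡ _))

  derivation-unique : (d : Fin N → Poly N) {E : Poly N → Poly N} →
    IsDerivation E → (∀ i → E (var i) ≈ d i) → ∀ f → E f ≈ derivation d f
  derivation-unique d {E} isE E≈d = go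
    where
    module E = IsDerivation isE
    open RingProperties P.ring using (x+x≈x⇒x≈0)
    E1≈0 : E (con 1ℚ) ≈ 0p
    E1≈0 = x+x≈x⇒x≈0 _ (begin
      E (con 1ℚ) :+ E (con 1ℚ)
        ≈⟨ +-cong (P.*-identityʳ _) (*-identityˡ _) ⟨
      E (con 1ℚ) :* con 1ℚ :+ con 1ℚ :* E (con 1ℚ)
        ≈⟨ E.leibniz _ _ ⟨
      E (con 1ℚ :* con 1ℚ)
        ≈⟨ E.cong (*-identityˡ _) ⟩
      E (con 1ℚ) ∎)
    go : ∀ f → E f ≈ derivation d f
    go (con q)  = trans (E.cong (sym (P.*-identityʳ _)))
      (trans (E.scale q _) (trans (*-cong refl E1≈0) (P.zeroʳ _)))
    go (var i)  = E≈d i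
    go (f :+ g) = trans (E.+-homo f g) (+-cong (go f) (go g))
    go (f :* g) = trans (E.leibniz f g)
      (+-cong (*-cong (go f) refl) (*-cong refl (go g)))

ker : ∀ {N} → (Poly N → Poly N) → Pred (Poly N) 0ℓ
ker D f = D f ≈ con 0ℚ

------------------------------------------------------------------------
-- Localisation of a commutative ring at the powers of one element

module Localisation {c ℓ : Level} (R : CommutativeRing c ℓ)
                    (s : CommutativeRing.Carrier R) where

  private
    module R = CommutativeRing R
    open Exp R.semiring using (_^_; ^-homo-*)
    open RingProperties R.ring using (-‿distribˡ-*)
    open SetoidReasoning R.setoid
    open SemiringSolver R.commutativeSemiring
      using (solve) renaming (_:=_ to _⊜_; _:+_ to _⊕_; _:*_ to _⊗_)

  infix 5 _/s^_

  record Frac : Set c where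
    constructor _/s^_
    field
      num : R.Carrier
      exp : ℕ

  infix 4 _≃_

  record _≃_ (u v : Frac) : Set ℓ where
    constructor mk≃
    open Frac
    field
      extra : ℕ
      eq    : s ^ extra R.* (num u R.* s ^ exp v) R.≈
              s ^ extra R.* (num v R.* s ^ exp u)

  infixl 6 _+_
  infixl 7 _*_
  infix  8 -_

  _+_ _*_ : Frac → Frac → Frac
  (a /s^ k) + (b /s^ l) = (a R.* s ^ l R.+ b R.* s ^ k) /s^ (k ℕ.+ l)
  (a /s^ k) * (b /s^ l) = (a R.* b) /s^ (k ℕ.+ l)

  -_ : Frac → Frac
  - (a /s^ k) = (R.- a) /s^ k

  ι : R.Carrier → Frac
  ι a = a /s^ 0

  s⁻¹ : Frac
  s⁻¹ = R.1# /s^ 1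

  private
    ^-+ : ∀ k l → s ^ (k ℕ.+ l) R.≈ s ^ k R.* s ^ l
    ^-+ = ^-homo-* s

    ^-+₃ : ∀ k l m → s ^ (k ℕ.+ l ℕ.+ m) R.≈ s ^ k R.* s ^ l R.* s ^ m
    ^-+₃ k l m = R.trans (^-+ (k ℕ.+ l) m) (R.*-congʳ (^-+ k l))

    cross : ∀ {u v} →
      Frac.num u R.* s ^ Frac.exp v R.≈ Frac.num v R.* s ^ Frac.exp u → u ≃ v
    cross p = mk≃ 0 (R.*-congˡ p)

    same : ∀ {a b k l} → a R.≈ b → k ≡ l → (a /s^ k) ≃ (b /s^ l)
    same a≈b ≡.refl = cross (R.*-congʳ a≈b)

    ≃-refl : ∀ {u} → u ≃ u
    ≃-refl = cross R.refl

    ≃-sym : ∀ {u v} → u ≃ v → v ≃ u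
    ≃-sym (mk≃ m p) = mk≃ m (R.sym p)

    ≃-trans : ∀ {u v w} → u ≃ v → v ≃ w → u ≃ w
    ≃-trans {a /s^ k} {b /s^ l} {d /s^ n} (mk≃ m p) (mk≃ m′ q) =
      mk≃ (m ℕ.+ m′ ℕ.+ l) (begin
        s ^ (m ℕ.+ m′ ℕ.+ l) R.* (a R.* s ^ n)
          ≈⟨ R.*-congʳ (^-+₃ m m′ l) ⟩
        s ^ m R.* s ^ m′ R.* s ^ l R.* (a R.* s ^ n)
          ≈⟨ solve 5 (λ x y z a t →
               (x ⊗ y ⊗ z ⊗ (a ⊗ t)) ⊜ (y ⊗ t ⊗ (x ⊗ (a ⊗ z))))
               R.refl (s ^ m) (s ^ m′) (s ^ l) a (s ^ n) ⟩
        s ^ m′ R.* s ^ n R.* (s ^ m R.* (a R.* s ^ l))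
          ≈⟨ R.*-congˡ p ⟩
        s ^ m′ R.* s ^ n R.* (s ^ m R.* (b R.* s ^ k))
          ≈⟨ solve 5 (λ x y z b t →
               (y ⊗ t ⊗ (x ⊗ (b ⊗ z))) ⊜ (x ⊗ z ⊗ (y ⊗ (b ⊗ t))))
               R.refl (s ^ m) (s ^ m′) (s ^ k) b (s ^ n) ⟩
        s ^ m R.* s ^ k R.* (s ^ m′ R.* (b R.* s ^ n))
          ≈⟨ R.*-congˡ q ⟩
        s ^ m R.* s ^ k R.* (s ^ m′ R.* (d R.* s ^ l))
          ≈⟨ solve 5 (λ x y z d t →
               (x ⊗ t ⊗ (y ⊗ (d ⊗ z))) ⊜ (x ⊗ y ⊗ z ⊗ (d ⊗ t)))
               R.refl (s ^ m) (s ^ m′) (s ^ l) d (s ^ k) ⟩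
        s ^ m R.* s ^ m′ R.* s ^ l R.* (d R.* s ^ k)
          ≈⟨ R.*-congʳ (^-+₃ m m′ l) ⟨
        s ^ (m ℕ.+ m′ ℕ.+ l) R.* (d R.* s ^ k) ∎)

    +-commL : ∀ u v → u + v ≃ v + u
    +-commL (a /s^ k) (b /s^ l) = same (R.+-comm _ _) (ℕ.+-comm k l)

    *-commL : ∀ u v → u * v ≃ v * u
    *-commL (a /s^ k) (b /s^ l) = same (R.*-comm _ _) (ℕ.+-comm k l)

    +-congʳL : ∀ {u v} w → u ≃ v → u + w ≃ v + w
    +-congʳL {a /s^ k} {b /s^ l} (d /s^ n) (mk≃ m p) = mk≃ m (begin
      s ^ m R.* ((a R.* s ^ n R.+ d R.* s ^ k) R.* s ^ (l ℕ.+ n))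
        ≈⟨ R.*-congˡ (R.*-congˡ (^-+ l n)) ⟩
      s ^ m R.* ((a R.* s ^ n R.+ d R.* s ^ k) R.* (s ^ l R.* s ^ n))
        ≈⟨ solve 6 (λ x y z t a d →
             (x ⊗ ((a ⊗ t ⊕ d ⊗ y) ⊗ (z ⊗ t)))
             ⊜ (t ⊗ t ⊗ (x ⊗ (a ⊗ z)) ⊕ x ⊗ d ⊗ y ⊗ z ⊗ t))
             R.refl (s ^ m) (s ^ k) (s ^ l) (s ^ n) a d ⟩
      s ^ n R.* s ^ n R.* (s ^ m R.* (a R.* s ^ l))
        R.+ s ^ m R.* d R.* s ^ k R.* s ^ l R.* s ^ n
        ≈⟨ R.+-congʳ (R.*-congˡ p) ⟩
      s ^ n R.* s ^ n R.* (s ^ m R.* (b R.* s ^ k))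
        R.+ s ^ m R.* d R.* s ^ k R.* s ^ l R.* s ^ n
        ≈⟨ solve 6 (λ x y z t b d →
             (t ⊗ t ⊗ (x ⊗ (b ⊗ y)) ⊕ x ⊗ d ⊗ y ⊗ z ⊗ t)
             ⊜ (x ⊗ ((b ⊗ t ⊕ d ⊗ z) ⊗ (y ⊗ t))))
             R.refl (s ^ m) (s ^ k) (s ^ l) (s ^ n) b d ⟩
      s ^ m R.* ((b R.* s ^ n R.+ d R.* s ^ l) R.* (s ^ k R.* s ^ n))
        ≈⟨ R.*-congˡ (R.*-congˡ (^-+ k n)) ⟨
      s ^ m R.* ((b R.* s ^ n R.+ d R.* s ^ l) R.* s ^ (k ℕ.+ n)) ∎)

    *-congʳL : ∀ {u v} w → u ≃ v → u * w ≃ v * w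
    *-congʳL {a /s^ k} {b /s^ l} (d /s^ n) (mk≃ m p) = mk≃ m (begin
      s ^ m R.* ((a R.* d) R.* s ^ (l ℕ.+ n))
        ≈⟨ R.*-congˡ (R.*-congˡ (^-+ l n)) ⟩
      s ^ m R.* ((a R.* d) R.* (s ^ l R.* s ^ n))
        ≈⟨ solve 5 (λ x z t a d →
             (x ⊗ ((a ⊗ d) ⊗ (z ⊗ t))) ⊜ (d ⊗ t ⊗ (x ⊗ (a ⊗ z))))
             R.refl (s ^ m) (s ^ l) (s ^ n) a d ⟩
      d R.* s ^ n R.* (s ^ m R.* (a R.* s ^ l))
        ≈⟨ R.*-congˡ p ⟩
      d R.* s ^ n R.* (s ^ m R.* (b R.* s ^ k))
        ≈⟨ solve 5 (λ x z t a d →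
             (d ⊗ t ⊗ (x ⊗ (a ⊗ z))) ⊜ (x ⊗ ((a ⊗ d) ⊗ (z ⊗ t))))
             R.refl (s ^ m) (s ^ k) (s ^ n) b d ⟩
      s ^ m R.* ((b R.* d) R.* (s ^ k R.* s ^ n))
        ≈⟨ R.*-congˡ (R.*-congˡ (^-+ k n)) ⟨
      s ^ m R.* ((b R.* d) R.* s ^ (k ℕ.+ n)) ∎)

    +-congL : ∀ {u u′ v v′} → u ≃ u′ → v ≃ v′ → u + v ≃ u′ + v′
    +-congL {u} {u′} {v} {v′} p q = ≃-trans (+-congʳL v p)
      (≃-trans (+-commL u′ v) (≃-trans (+-congʳL u′ q) (+-commL v′ u′)))

    *-congL : ∀ {u u′ v v′} → u ≃ u′ → v ≃ v′ → u * v ≃ u′ * v′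
    *-congL {u} {u′} {v} {v′} p q = ≃-trans (*-congʳL v p)
      (≃-trans (*-commL u′ v) (≃-trans (*-congʳL u′ q) (*-commL v′ u′)))

    -‿congL : ∀ {u v} → u ≃ v → - u ≃ - v
    -‿congL {a /s^ k} {b /s^ l} (mk≃ m p) =
      mk≃ m (R.trans (out a l) (R.trans (R.-‿cong p) (R.sym (out b k))))
      where
      open RingProperties R.ring using (-‿distribʳ-*)
      out : ∀ x j → s ^ m R.* (R.- x R.* s ^ j) R.≈ R.- (s ^ m R.* (x R.* s ^ j))
      out x j = R.trans (R.*-congˡ (R.sym (-‿distribˡ-* x (s ^ j))))
                        (R.sym (-‿distribʳ-* _ _))

    +-assocL : ∀ u v w → (u + v) + w ≃ u + (v + w)
    +-assocL (a /s^ k) (b /s^ l) (d /s^ n) = same (begin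
      (a R.* s ^ l R.+ b R.* s ^ k) R.* s ^ n R.+ d R.* s ^ (k ℕ.+ l)
        ≈⟨ R.+-congˡ (R.*-congˡ (^-+ k l)) ⟩
      (a R.* s ^ l R.+ b R.* s ^ k) R.* s ^ n R.+ d R.* (s ^ k R.* s ^ l)
        ≈⟨ solve 6 (λ a b d y z t →
             ((a ⊗ z ⊕ b ⊗ y) ⊗ t ⊕ d ⊗ (y ⊗ z))
             ⊜ (a ⊗ (z ⊗ t) ⊕ (b ⊗ t ⊕ d ⊗ z) ⊗ y))
             R.refl a b d (s ^ k) (s ^ l) (s ^ n) ⟩
      a R.* (s ^ l R.* s ^ n) R.+ (b R.* s ^ n R.+ d R.* s ^ l) R.* s ^ k
        ≈⟨ R.+-congʳ (R.*-congˡ (^-+ l n)) ⟨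
      a R.* s ^ (l ℕ.+ n) R.+ (b R.* s ^ n R.+ d R.* s ^ l) R.* s ^ k ∎)
      (ℕ.+-assoc k l n)

    *-assocL : ∀ u v w → (u * v) * w ≃ u * (v * w)
    *-assocL (a /s^ k) (b /s^ l) (d /s^ n) =
      same (R.*-assoc a b d) (ℕ.+-assoc k l n)

    +-identityˡL : ∀ u → ι R.0# + u ≃ u
    +-identityˡL (a /s^ k) = same
      (R.trans (R.+-cong (R.zeroˡ _) (R.*-identityʳ a)) (R.+-identityˡ a)) ≡.refl

    *-identityˡL : ∀ u → ι R.1# * u ≃ u
    *-identityˡL (a /s^ k) = same (R.*-identityˡ a) ≡.refl

    +-inverseˡL : ∀ u → - u + u ≃ ι R.0#
    +-inverseˡL (a /s^ k) = cross (begin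
      (R.- a R.* s ^ k R.+ a R.* s ^ k) R.* s ^ 0  ≈⟨ R.*-identityʳ _ ⟩
      R.- a R.* s ^ k R.+ a R.* s ^ k              ≈⟨ R.distribʳ _ _ _ ⟨
      (R.- a R.+ a) R.* s ^ k                      ≈⟨ R.*-congʳ (R.-‿inverseˡ a) ⟩
      R.0# R.* s ^ k                               ≈⟨ R.zeroˡ _ ⟩
      R.0#                                         ≈⟨ R.zeroˡ _ ⟨
      R.0# R.* s ^ (k ℕ.+ k)                       ∎)

    distribˡL : ∀ u v w → u * (v + w) ≃ u * v + u * w
    distribˡL (a /s^ k) (b /s^ l) (d /s^ n) = cross (begin
      a R.* (b R.* s ^ n R.+ d R.* s ^ l) R.* s ^ (k ℕ.+ l ℕ.+ (k ℕ.+ n))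
        ≈⟨ R.*-congˡ (R.trans (^-+₃ k l (k ℕ.+ n)) (R.*-congˡ (^-+ k n))) ⟩
      a R.* (b R.* s ^ n R.+ d R.* s ^ l) R.* (s ^ k R.* s ^ l R.* (s ^ k R.* s ^ n))
        ≈⟨ solve 6 (λ a b d y z t →
             (a ⊗ (b ⊗ t ⊕ d ⊗ z) ⊗ (y ⊗ z ⊗ (y ⊗ t)))
             ⊜ ((a ⊗ b ⊗ (y ⊗ t) ⊕ a ⊗ d ⊗ (y ⊗ z)) ⊗ (y ⊗ (z ⊗ t))))
             R.refl a b d (s ^ k) (s ^ l) (s ^ n) ⟩
      (a R.* b R.* (s ^ k R.* s ^ n) R.+ a R.* d R.* (s ^ k R.* s ^ l))
        R.* (s ^ k R.* (s ^ l R.* s ^ n))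
        ≈⟨ R.*-cong (R.+-cong (R.*-congˡ (^-+ k n)) (R.*-congˡ (^-+ k l)))
                    (R.trans (^-+ k (l ℕ.+ n)) (R.*-congˡ (^-+ l n))) ⟨
      (a R.* b R.* s ^ (k ℕ.+ n) R.+ a R.* d R.* s ^ (k ℕ.+ l))
        R.* s ^ (k ℕ.+ (l ℕ.+ n)) ∎)

  localisation : CommutativeRing c ℓ
  localisation = record
    { Carrier = Frac
    ; _≈_ = _≃_
    ; _+_ = _+_
    ; _*_ = _*_
    ; -_ = -_
    ; 0# = ι R.0#
    ; 1# = ι R.1#
    ; isCommutativeRing = record
      { isRing = record
        { +-isAbelianGroup = record
          { isGroup = record
            { isMonoid = record
              { isSemigroup = record
                { isMagma = record
                  { isEquivalence = record
                      { refl = ≃-refl ; sym = ≃-sym ; trans = ≃-trans }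
                  ; ∙-cong = +-congL
                  }
                ; assoc = +-assocL
                }
              ; identity = +-identityˡL
                , λ u → ≃-trans (+-commL u _) (+-identityˡL u)
              }
            ; inverse = +-inverseˡL
              , λ u → ≃-trans (+-commL u _) (+-inverseˡL u)
            ; ⁻¹-cong = -‿congL
            }
          ; comm = +-commL
          }
        ; *-cong = *-congL
        ; *-assoc = *-assocL
        ; *-identity = *-identityˡL
          , λ u → ≃-trans (*-commL u _) (*-identityˡL u)
        ; distrib = distribˡL , λ u v w → ≃-trans (*-commL _ u)
            (≃-trans (distribˡL u v w) (+-congL (*-commL u v) (*-commL u w)))
        }
      ; *-comm = *-commL
      }
    }

  ι-isRingHomomorphism :
    RingMorphisms.IsRingHomomorphism R.rawRing (CommutativeRing.rawRing localisation) ι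
  ι-isRingHomomorphism = record
    { isSemiringHomomorphism = record
      { isNearSemiringHomomorphism = record
        { +-isMonoidHomomorphism = record
          { isMagmaHomomorphism = record
            { isRelHomomorphism = record { cong = λ p → same p ≡.refl }
            ; homo = λ _ _ → same
                (R.+-cong (R.sym (R.*-identityʳ _)) (R.sym (R.*-identityʳ _))) ≡.refl
            }
          ; ε-homo = ≃-refl
          }
        ; *-homo = λ _ _ → ≃-refl
        }
      ; 1#-homo = ≃-refl
      }
    ; -‿homo = λ _ → ≃-refl
    }

  ιs*s⁻¹≃1 : ι s * s⁻¹ ≃ ι R.1#
  ιs*s⁻¹≃1 = cross (R.trans (R.*-identityʳ _)
    (R.trans (R.*-identityʳ s)
      (R.sym (R.trans (R.*-identityˡ _) (R.*-identityʳ s)))))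

------------------------------------------------------------------------
-- Subrings and images

module _ {c ℓ : Level} (R : CommutativeRing c ℓ) where

  open CommutativeRing R using (Carrier; 1#; _+_; _*_; -_)
    renaming (_≈_ to _≈R_)

  -- B[S]: the smallest subring, closed under the ring's equality,
  -- containing B and S.
  data adjoin {p q : Level} (B : Pred Carrier p) (S : Pred Carrier q)
              : Pred Carrier (c ⊔ ℓ ⊔ p ⊔ q) where
    base : ∀ {u} → u ∈ B → u ∈ adjoin B S
    gen  : ∀ {u} → u ∈ S → u ∈ adjoin B S
    one  : 1# ∈ adjoin B S
    add  : ∀ {u v} → u ∈ adjoin B S → v ∈ adjoin B S → (u + v) ∈ adjoin B S
    mul  : ∀ {u v} → u ∈ adjoin B S → v ∈ adjoin B S → (u * v) ∈ adjoin B S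
    neg  : ∀ {u} → u ∈ adjoin B S → (- u) ∈ adjoin B S
    resp : ∀ {u v} → u ≈R v → u ∈ adjoin B S → v ∈ adjoin B S

  image : ∀ {a p} {A : Set a} → (A → Carrier) → Pred A p → Pred Carrier (a ⊔ ℓ ⊔ p)
  image h P u = ∃[ f ] f ∈ P × u ≈R h f

------------------------------------------------------------------------
-- The first Kravchuk derivation and its Cayley elements

module Kravchuk (n : ℕ) (2≤n : 2 ℕ.≤ n) where

  ℚ[x] : Set
  ℚ[x] = Poly (suc n)

  private
    module P = CommutativeRing (polyRing (suc n))
    open SumProperties P.+-commutativeMonoid using (sum)
    open Exp P.semiring using (_^_)

  x₀ x₁ : ℚ[x]
  x₀ = var zero
  x₁ = var (fromℕ< (s≤s (ℕ.≤-trans (ℕ.n≤1+n 1) 2≤n)))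

  -- (1 - (-1)^i) / 2i for i = j + 1
  coeff : ℕ → ℚ
  coeff j = (1ℤ ℤ.- -1ℤ ℤ.^ suc j) ℚ./ (2 ℕ.* suc j)

  -- The sum over 1 ≤ i ≤ m is indexed by j = i - 1 : Fin m; then opposite j
  -- is the number m - 1 - j = m - i.
  𝒟x : Fin (suc n) → ℚ[x]
  𝒟x m = sum {toℕ m} λ j → con (coeff (toℕ j)) :* var (inject {i = m} (opposite j))

  𝒟 : ℚ[x] → ℚ[x]
  𝒟 = derivation 𝒟x

  private
    iterate-cong : ∀ k {f g} → f ≈ g → iterate 𝒟 f k ≈ iterate 𝒟 g k
    iterate-cong zero    p = p
    iterate-cong (suc k) p =
      iterate-cong k (IsDerivation.cong (derivation-isDerivation 𝒟x) p)

    iterate-con : ∀ k → iterate 𝒟 (con 0ℚ) k ≈ con 0ℚ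
    iterate-con zero    = refl
    iterate-con (suc k) = iterate-con k

    iterate-+ : ∀ k f g → iterate 𝒟 (f :+ g) k ≈ iterate 𝒟 f k :+ iterate 𝒟 g k
    iterate-+ zero    f g = refl
    iterate-+ (suc k) f g = iterate-+ k (𝒟 f) (𝒟 g)

    iterate-scale : ∀ k q f → iterate 𝒟 (con q :* f) k ≈ con q :* iterate 𝒟 f k
    iterate-scale zero    q f = refl
    iterate-scale (suc k) q f = trans
      (iterate-cong k (IsDerivation.scale (derivation-isDerivation 𝒟x) q f))
      (iterate-scale k q (𝒟 f))

    iterate-sum : ∀ k {l} (t : Fin l → ℚ[x]) →
      (∀ j → iterate 𝒟 (t j) k ≈ con 0ℚ) → iterate 𝒟 (sum t) k ≈ con 0ℚ
    iterate-sum k {zero}  t p = iterate-con k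
    iterate-sum k {suc l} t p = trans (iterate-+ k (t zero) _)
      (trans (+-cong (p zero) (iterate-sum k (λ j → t (suc j)) (λ j → p (suc j))))
             (+-identityˡ _))

  𝒟^k[x_m]≈0 : ∀ k m → toℕ m ℕ.< k → iterate 𝒟 (var m) k ≈ con 0ℚ
  𝒟^k[x_m]≈0 (suc k) m (s≤s m≤k) = iterate-sum k _ λ j →
    trans (iterate-scale k (coeff (toℕ j)) _)
    (trans (*-cong refl (𝒟^k[x_m]≈0 k (inject {i = m} (opposite j))
      (≡.subst (ℕ._< k) (≡.sym (toℕ-inject {i = m} (opposite j)))
        (ℕ.<-≤-trans (toℕ<n (opposite j)) m≤k))))
     (P.zeroʳ _))

  open Localisation (polyRing (suc n)) x₀ public
    using (Frac; _/s^_; _≃_; mk≃; ι; localisation)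
    renaming (s⁻¹ to x₀⁻¹)

  private
    module L = CommutativeRing localisation
    module LSum = SumProperties L.+-commutativeMonoid
    module LExp = Exp L.semiring

  -x₁/x₀ : Frac
  -x₁/x₀ = L.- (ι x₁ L.* x₀⁻¹)

  1/!_ : ℕ → ℚ
  1/! k = (1ℤ ℚ./ (k !)) {{k ℕ.!≢0}}

  -- The terms with k > m of the series vanish, by 𝒟^k[x_m]≈0 below.
  σx : Fin (suc n) → Frac
  σx m = LSum.sum {suc (toℕ m)} λ k →
    ι (iterate 𝒟 (var m) (toℕ k)) L.* (ι (con (1/! toℕ k)) L.* -x₁/x₀ LExp.^ toℕ k)

  -- Only the values at 2 ≤ m are Cayley elements.
  C : Fin (suc n) → Frac
  C m = ι (con (+ (toℕ m ℕ.* (toℕ m ∸ 2) !) ℚ./ 1) :* x₀ ^ (toℕ m ∸ 1)) L.* σx m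

  Cayley : Pred Frac 0ℓ
  Cayley u = ∃[ m ] 2 ℕ.≤ toℕ m × u ≡ C m

  constants : Pred Frac 0ℓ
  constants = image localisation (λ q → ι (con q)) U

  ℚ[x₀,C₂,…,Cₙ] : Pred Frac 0ℓ
  ℚ[x₀,C₂,…,Cₙ] = adjoin localisation constants (｛ ι x₀ ｝ ∪ Cayley)

  ℚ[x₀,C₂,…,Cₙ][x₀⁻¹] : Pred Frac 0ℓ
  ℚ[x₀,C₂,…,Cₙ][x₀⁻¹] = adjoin localisation ℚ[x₀,C₂,…,Cₙ] ｛ x₀⁻¹ ｝

  ι-injective : ∀ {f g} → ι f ≃ ι g → f ≈ g
  ι-injective (mk≃ m p) =
    trans (sym (P.*-identityʳ _)) (trans (cancel m p) (P.*-identityʳ _))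
    where
    cancel : ∀ m {f g} → x₀ ^ m :* f ≈ x₀ ^ m :* g → f ≈ g
    cancel zero    p = trans (sym (*-identityˡ _)) (trans p (*-identityˡ _))
    cancel (suc m) p = cancel m (x₀-cancelˡ
      (trans (sym (*-assoc _ _ _)) (trans p (*-assoc _ _ _))))

{-# OPTIONS --safe #-}

-- The derivation extends to the localisation at x₀, where s = x₁/x₀ is a
-- slice: it has derivative 1.  Let B = ℚ[x₀,C₂,…,Cₙ][x₀⁻¹].  The derivative
-- of the series σ(x_m) telescopes to 0, so B consists of constants.
-- Conversely σ(x_m) - x_m is a combination of powers of s with coefficients
-- in the variables below x_m, so by induction every x_m lies in B[s].  As s
-- is transcendental over the constants and derivation acts on B[s] as d/ds,
-- the constants of B[s] are the elements of B.

module Submission where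

open import Algebra.Bundles using (CommutativeRing)
open import Algebra.Morphism.Construct.Composition using (isRingHomomorphism)
open import Algebra.Morphism.Structures using (module RingMorphisms)
open import Data.Fin.Base using (Fin; zero; suc; toℕ; opposite)
open import Data.Fin.Properties using (toℕ<n; toℕ-inject; toℕ-injective; toℕ-fromℕ<)
import Data.Integer.Base as ℤ
import Data.Integer.Properties as ℤ
open import Data.Nat.Base as ℕ using (ℕ; zero; suc; _≤_; s≤s; _!; _∸_)
open import Data.Nat.GeneralisedArithmetic using (iterate)
open import Data.Nat.Induction using (<-rec)
import Data.Nat.Properties as ℕ
open import Data.Product.Base using (∃-syntax; _×_; _,_)
open import Data.Rational.Base as ℚ using (ℚ; 1ℚ)
import Data.Rational.Properties as ℚ
import Data.Rational.Unnormalised.Base as ℚᵘ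
import Data.Rational.Unnormalised.Properties as ℚᵘ
open import Data.Sum.Base using (inj₁; inj₂)
open import Data.Vec.Base using (Vec; []; _∷_)
open import Data.Vec.Relation.Unary.All using (All; []; _∷_)
open import Level using (_⊔_)
open import Relation.Binary.PropositionalEquality as ≡ using (_≡_)
open import Relation.Unary using (Pred; _∈_; _⊆_; _≐_; _∩_; ｛_｝; U)
import Algebra.Properties.CommutativeMonoid.Mult as CommutativeMonoidMult
import Algebra.Properties.Group as GroupProperties
import Algebra.Properties.Ring as RingProperties
import Algebra.Properties.Semiring.Exp as Exp
import Algebra.Properties.Semiring.Mult as Mult
import Algebra.Properties.Semiring.Sum as Sum
import Algebra.Solver.Ring.NaturalCoefficients.Default as SemiringSolver
import Relation.Binary.Reasoning.Setoid as SetoidReasoning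

open import Defs hiding
  ( _≈_; refl; sym; trans; +-cong; *-cong; +-assoc; +-comm; +-identityˡ
  ; *-assoc; *-comm; *-identityˡ; distribˡ; zeroˡ )

-- Preliminaries on commutative rings.

module _ {c ℓ} (R : CommutativeRing c ℓ) where

  open CommutativeRing R hiding (zero)
  open Exp semiring using (_^_)
  open Mult semiring renaming (_×_ to _·_)
  open Sum semiring using (sum)
  open SetoidReasoning setoid
  open SemiringSolver commutativeSemiring
    using (solve; _:=_) renaming (_:+_ to _⊕_; _:*_ to _⊗_)

  -- The form in which characteristic 0 enters the slice argument; indexing by `suc k` excludes the
  -- multiplier 0.
  TorsionFree : Set (c ⊔ ℓ)
  TorsionFree = ∀ k {a} → suc k · a ≈ 0# → a ≈ 0#

  ^-inverse : ∀ {x y} → x * y ≈ 1# → ∀ k → x ^ k * y ^ k ≈ 1#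
  ^-inverse xy≈1 zero    = *-identityˡ 1#
  ^-inverse {x} {y} xy≈1 (suc k) = begin
    x * x ^ k * (y * y ^ k)
      ≈⟨ solve 4 (λ a b c d → a ⊗ b ⊗ (c ⊗ d) := (a ⊗ c) ⊗ (b ⊗ d)) refl
           x (x ^ k) y (y ^ k) ⟩
    x * y * (x ^ k * y ^ k)
      ≈⟨ *-cong xy≈1 (^-inverse xy≈1 k) ⟩
    1# * 1#
      ≈⟨ *-identityˡ 1# ⟩
    1# ∎

  telescope : ∀ (a : ℕ → Carrier) k →
    sum {k} (λ i → a (suc (toℕ i)) - a (toℕ i)) ≈ a k - a 0
  telescope a zero    = sym (-‿inverseʳ (a 0))
  telescope a (suc k) = begin
    a 1 - a 0 + sum {k} (λ i → a (suc (suc (toℕ i))) - a (suc (toℕ i)))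
      ≈⟨ +-congˡ (telescope (λ i → a (suc i)) k) ⟩
    a 1 - a 0 + (a (suc k) - a 1)
      ≈⟨ solve 4 (λ x x′ y z → (x ⊕ y) ⊕ (z ⊕ x′) := (x ⊕ x′) ⊕ (z ⊕ y))
           refl (a 1) (- a 1) (- a 0) (a (suc k)) ⟩
    a 1 - a 1 + (a (suc k) - a 0)
      ≈⟨ trans (+-congʳ (-‿inverseʳ (a 1))) (+-identityˡ _) ⟩
    a (suc k) - a 0 ∎

-- Derivations of a commutative ring and their constants.

record IsDerivationOn {c ℓ} (R : CommutativeRing c ℓ)
    (D : CommutativeRing.Carrier R → CommutativeRing.Carrier R) : Set (c ⊔ ℓ) where
  open CommutativeRing R hiding (zero)
  field
    D-cong : ∀ {a b} → a ≈ b → D a ≈ D b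
    D-+    : ∀ a b → D (a + b) ≈ D a + D b
    D-*    : ∀ a b → D (a * b) ≈ D a * b + a * D b

module DerivationProperties {c ℓ} (R : CommutativeRing c ℓ)
    {D : CommutativeRing.Carrier R → CommutativeRing.Carrier R}
    (isD : IsDerivationOn R D) where

  open CommutativeRing R hiding (zero)
  open IsDerivationOn isD
  open RingProperties ring using (x+x≈x⇒x≈0)
  open GroupProperties +-group using (inverseˡ-unique; ε⁻¹≈ε)
  open Exp semiring using (_^_)
  open Mult semiring using (×-congʳ; ×-comm-*) renaming (_×_ to _·_)
  open Sum semiring using (sum)
  open SetoidReasoning setoid

  D-0 : D 0# ≈ 0#
  D-0 = x+x≈x⇒x≈0 _ (trans (sym (D-+ 0# 0#)) (D-cong (+-identityˡ 0#)))

  D-1 : D 1# ≈ 0#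
  D-1 = x+x≈x⇒x≈0 _ (begin
    D 1# + D 1#            ≈⟨ +-cong (*-identityʳ _) (*-identityˡ _) ⟨
    D 1# * 1# + 1# * D 1#  ≈⟨ D-* 1# 1# ⟨
    D (1# * 1#)            ≈⟨ D-cong (*-identityˡ 1#) ⟩
    D 1#                   ∎)

  D-neg : ∀ a → D (- a) ≈ - D a
  D-neg a = inverseˡ-unique _ _
    (trans (sym (D-+ (- a) a)) (trans (D-cong (-‿inverseˡ a)) D-0))

  D-constantˡ : ∀ {a} b → D a ≈ 0# → D (a * b) ≈ a * D b
  D-constantˡ b Da≈0 = trans (D-* _ b)
    (trans (+-congʳ (trans (*-congʳ Da≈0) (zeroˡ b))) (+-identityˡ _))

  D-constantʳ : ∀ a {b} → D b ≈ 0# → D (a * b) ≈ D a * b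
  D-constantʳ a Db≈0 = trans (D-* a _)
    (trans (+-congˡ (trans (*-congˡ Db≈0) (zeroʳ a))) (+-identityʳ _))

  D-constant-* : ∀ {a b} → D a ≈ 0# → D b ≈ 0# → D (a * b) ≈ 0#
  D-constant-* Da≈0 Db≈0 =
    trans (D-constantˡ _ Da≈0) (trans (*-congˡ Db≈0) (zeroʳ _))

  D-constant-^ : ∀ {a} → D a ≈ 0# → ∀ k → D (a ^ k) ≈ 0#
  D-constant-^ Da≈0 zero    = D-1
  D-constant-^ Da≈0 (suc k) = D-constant-* Da≈0 (D-constant-^ Da≈0 k)

  D-· : ∀ k a → D (k · a) ≈ k · D a
  D-· zero    a = D-0
  D-· (suc k) a = trans (D-+ a _) (+-congˡ (D-· k a))

  D-^ : ∀ a k → D (a ^ suc k) ≈ suc k · (a ^ k * D a)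
  D-^ a zero = begin
    D (a * 1#)      ≈⟨ D-cong (*-identityʳ a) ⟩
    D a             ≈⟨ *-identityˡ _ ⟨
    1# * D a        ≈⟨ +-identityʳ _ ⟨
    1# * D a + 0#   ∎
  D-^ a (suc k) = begin
    D (a * a ^ suc k)
      ≈⟨ D-* a _ ⟩
    D a * a ^ suc k + a * D (a ^ suc k)
      ≈⟨ +-cong (*-comm _ _) (*-congˡ (D-^ a k)) ⟩
    a ^ suc k * D a + a * (suc k · (a ^ k * D a))
      ≈⟨ +-congˡ (×-comm-* (suc k) a _) ⟩
    a ^ suc k * D a + suc k · (a * (a ^ k * D a))
      ≈⟨ +-congˡ (×-congʳ (suc k) (*-assoc a _ _)) ⟨
    suc (suc k) · (a ^ suc k * D a) ∎

  D-sum : ∀ {k} (t : Fin k → Carrier) → D (sum t) ≈ sum (λ i → D (t i))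
  D-sum {zero}  t = D-0
  D-sum {suc k} t = trans (D-+ _ _) (+-congˡ (D-sum (λ i → t (suc i))))

  -- The constants of a derivation form a subring closed under the ring's equality, so only the
  -- generators have to be checked.
  adjoin-constant : ∀ {p q} {P : Pred Carrier p} {S : Pred Carrier q} →
    (∀ {u} → u ∈ P → D u ≈ 0#) → (∀ {u} → u ∈ S → D u ≈ 0#) →
    ∀ {u} → u ∈ adjoin R P S → D u ≈ 0#
  adjoin-constant P₀ S₀ (base u∈P) = P₀ u∈P
  adjoin-constant P₀ S₀ (gen u∈S)  = S₀ u∈S
  adjoin-constant P₀ S₀ one        = D-1
  adjoin-constant P₀ S₀ (add u v)  = trans (D-+ _ _)
    (trans (+-cong (adjoin-constant P₀ S₀ u) (adjoin-constant P₀ S₀ v))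
           (+-identityˡ 0#))
  adjoin-constant P₀ S₀ (mul u v)  =
    D-constant-* (adjoin-constant P₀ S₀ u) (adjoin-constant P₀ S₀ v)
  adjoin-constant P₀ S₀ (neg u)    = trans (D-neg _)
    (trans (-‿cong (adjoin-constant P₀ S₀ u)) ε⁻¹≈ε)
  adjoin-constant P₀ S₀ (resp u≈v u) =
    trans (D-cong (sym u≈v)) (adjoin-constant P₀ S₀ u)

-- Closure properties of adjoined subrings.

module AdjoinProperties {c ℓ} (R : CommutativeRing c ℓ) {p q}
    {P : Pred (CommutativeRing.Carrier R) p}
    {S : Pred (CommutativeRing.Carrier R) q} where

  open CommutativeRing R hiding (zero)
  open Sum semiring using (sum)
  open Exp semiring using (_^_)

  zero∈adjoin : 0# ∈ adjoin R P S
  zero∈adjoin = resp (-‿inverseʳ 1#) (add one (neg one))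

  sum∈adjoin : ∀ {k} (t : Fin k → Carrier) →
    (∀ i → t i ∈ adjoin R P S) → sum t ∈ adjoin R P S
  sum∈adjoin {zero}  t t∈ = zero∈adjoin
  sum∈adjoin {suc k} t t∈ = add (t∈ zero) (sum∈adjoin _ (λ i → t∈ (suc i)))

  ^∈adjoin : ∀ {u} → u ∈ adjoin R P S → ∀ k → u ^ k ∈ adjoin R P S
  ^∈adjoin u∈ zero    = one
  ^∈adjoin u∈ (suc k) = mul u∈ (^∈adjoin u∈ k)

-- Polynomials in a slice with constant coefficients.

module Slice {c ℓ} (R : CommutativeRing c ℓ)
    {D : CommutativeRing.Carrier R → CommutativeRing.Carrier R}
    (isD : IsDerivationOn R D)
    (torsion-free : TorsionFree R)
    {s : CommutativeRing.Carrier R}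
    (Ds≈1 : CommutativeRing._≈_ R (D s) (CommutativeRing.1# R)) where

  open CommutativeRing R hiding (zero)
  open IsDerivationOn isD
  open DerivationProperties R isD
  open RingProperties ring using (-1*x≈-x)
  open Mult semiring using (×-congʳ; ×-comm-*) renaming (_×_ to _·_)
  open CommutativeMonoidMult +-commutativeMonoid using (×-distrib-+)
  open SetoidReasoning setoid
  open SemiringSolver commutativeSemiring
    using (solve; _:=_) renaming (_:+_ to _⊕_; _:*_ to _⊗_)

  ·-zeroʳ : ∀ c → c · 0# ≈ 0#
  ·-zeroʳ zero    = refl
  ·-zeroʳ (suc c) = trans (+-identityˡ _) (·-zeroʳ c)

  -- The vector lists coefficients with the constant term first. Horner's scheme avoids powers of
  -- `s`, so every later argument is a recursion on the vector.
  horner : ∀ {k} → Vec Carrier k → Carrier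
  horner []      = 0#
  horner (b ∷ p) = b + s * horner p

  -- The coefficient of s^i is multiplied by c + i: this is the operator c + s d/ds, written on
  -- coefficients.
  weigh : ∀ {k} → ℕ → Vec Carrier k → Vec Carrier k
  weigh c []      = []
  weigh c (b ∷ p) = c · b ∷ weigh (suc c) p

  Constants : ∀ {k} → Vec Carrier k → Set _
  Constants = All (λ b → D b ≈ 0#)

  weigh-constants : ∀ {k} c {p : Vec Carrier k} → Constants p → Constants (weigh c p)
  weigh-constants c []        = []
  weigh-constants c (Db ∷ Dp) =
    trans (D-· c _) (trans (×-congʳ c Db) (·-zeroʳ c)) ∷ weigh-constants (suc c) Dp

  D-horner-∷ : ∀ {k b} (p : Vec Carrier k) → D b ≈ 0# →
    D (horner (b ∷ p)) ≈ horner p + s * D (horner p)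
  D-horner-∷ {b = b} p Db≈0 = begin
    D (b + s * horner p)                 ≈⟨ D-+ _ _ ⟩
    D b + D (s * horner p)               ≈⟨ trans (+-congʳ Db≈0) (+-identityˡ _) ⟩
    D (s * horner p)                     ≈⟨ D-* _ _ ⟩
    D s * horner p + s * D (horner p)    ≈⟨ +-congʳ (trans (*-congʳ Ds≈1) (*-identityˡ _)) ⟩
    horner p + s * D (horner p)          ∎

  -- Each monomial s^i is an eigenvector of c + s D with eigenvalue c + i. A general `c` is needed
  -- for the induction: peeling off one coefficient raises it by 1.
  euler : ∀ {k} c {p : Vec Carrier k} → Constants p →
    c · horner p + s * D (horner p) ≈ horner (weigh c p)
  euler c []                = trans
    (+-cong (·-zeroʳ c) (trans (*-congˡ D-0) (zeroʳ s))) (+-identityˡ 0#)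
  euler c {b ∷ p} (Db ∷ Dp) = begin
    c · (b + s * h) + s * D (b + s * h)
      ≈⟨ +-cong (×-distrib-+ b (s * h) c) (*-congˡ (D-horner-∷ p Db)) ⟩
    c · b + c · (s * h) + s * (h + s * D h)
      ≈⟨ +-congʳ (+-congˡ (×-comm-* c s h)) ⟨
    c · b + s * (c · h) + s * (h + s * D h)
      ≈⟨ solve 5 (λ x y z s d → x ⊕ s ⊗ y ⊕ s ⊗ (z ⊕ s ⊗ d)
                              := x ⊕ s ⊗ ((z ⊕ y) ⊕ s ⊗ d))
           refl (c · b) (c · h) h s (D h) ⟩
    c · b + s * (suc c · h + s * D h)
      ≈⟨ +-congˡ (*-congˡ (euler (suc c) Dp)) ⟩
    c · b + s * horner (weigh (suc c) p) ∎
    where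
    h = horner p

  -- The derivative of b + s h is h + s D h, which is the case c = 1 of `euler`.
  D-horner : ∀ {k b} {p : Vec Carrier k} → D b ≈ 0# → Constants p →
    D (horner (b ∷ p)) ≈ horner (weigh 1 p)
  D-horner {p = p} Db Dp = begin
    D (horner (_ ∷ p))              ≈⟨ D-horner-∷ p Db ⟩
    horner p + s * D (horner p)     ≈⟨ +-congʳ (+-identityʳ _) ⟨
    1 · horner p + s * D (horner p) ≈⟨ euler 1 Dp ⟩
    horner (weigh 1 p)              ∎

  Zeros : ∀ {k} → Vec Carrier k → Set _
  Zeros = All (_≈ 0#)

  -- Starting at `suc c` keeps every weight positive, so torsion-freeness cancels each of them.
  weigh-zeros : ∀ {k} c {p : Vec Carrier k} → Zeros (weigh (suc c) p) → Zeros p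
  weigh-zeros c {[]}    []       = []
  weigh-zeros c {b ∷ p} (z ∷ zs) = torsion-free c z ∷ weigh-zeros (suc c) zs

  horner-zeros : ∀ {k} {p : Vec Carrier k} → Zeros p → horner p ≈ 0#
  horner-zeros []       = refl
  horner-zeros (z ∷ zs) =
    trans (+-cong z (trans (*-congˡ (horner-zeros zs)) (zeroʳ s))) (+-identityˡ 0#)

  -- s is transcendental over the constants: differentiating a relation
  -- of degree k gives one of degree k - 1.
  horner-injective : ∀ {k} {p : Vec Carrier k} →
    Constants p → horner p ≈ 0# → Zeros p
  D-horner-zeros : ∀ {k b} {p : Vec Carrier k} → D b ≈ 0# → Constants p →
    D (horner (b ∷ p)) ≈ 0# → Zeros p

  horner-injective []                        _   = []
  horner-injective {p = b ∷ p} (Db ∷ Dp) p≈0 = b≈0 ∷ zs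
    where
    zs : Zeros p
    zs = D-horner-zeros Db Dp (trans (D-cong p≈0) D-0)
    b≈0 : b ≈ 0#
    b≈0 = begin
      b                ≈⟨ +-identityʳ b ⟨
      b + 0#           ≈⟨ +-congˡ (trans (*-congˡ (horner-zeros zs)) (zeroʳ s)) ⟨
      b + s * horner p ≈⟨ p≈0 ⟩
      0#               ∎

  D-horner-zeros Db Dp D≈0 = weigh-zeros 0
    (horner-injective (weigh-constants 1 Dp) (trans (sym (D-horner Db Dp)) D≈0))

  module _ {p q} {P : Pred Carrier p} {S : Pred Carrier q}
           (constant : ∀ {u} → u ∈ adjoin R P S → D u ≈ 0#) where

    open AdjoinProperties R {P = P} {S = S}

    private
      B = adjoin R P S

    -- A normal form for B[s]: `adjoin` presents an element only as a nest of ring operations,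
    -- whereas comparing derivatives requires its coefficients.
    Horner : Pred Carrier _
    Horner u = ∃[ k ] ∃[ p ] All B {k} p × u ≈ horner p

    Horner-resp : ∀ {u v} → u ≈ v → Horner u → Horner v
    Horner-resp u≈v (k , p , p∈ , u≈p) = k , p , p∈ , trans (sym u≈v) u≈p

    Horner-∷ : ∀ {b u} → b ∈ B → Horner u → Horner (b + s * u)
    Horner-∷ {b} b∈ (k , p , p∈ , u≈p) =
      suc k , b ∷ p , b∈ ∷ p∈ , +-congˡ (*-congˡ u≈p)

    Horner-0 : Horner 0#
    Horner-0 = 0 , [] , [] , refl

    Horner-base : ∀ {b} → b ∈ B → Horner b
    Horner-base b∈ = Horner-resp (trans (+-congˡ (zeroʳ s)) (+-identityʳ _))
      (Horner-∷ b∈ Horner-0)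

    Horner-s* : ∀ {u} → Horner u → Horner (s * u)
    Horner-s* u∈ = Horner-resp (+-identityˡ _) (Horner-∷ zero∈adjoin u∈)

    Horner-+ : ∀ {u v} → Horner u → Horner v → Horner (u + v)
    Horner-+ (_ , p , p∈ , u≈p) (_ , q , q∈ , v≈q) =
      Horner-resp (sym (+-cong u≈p v≈q)) (go p∈ q∈)
      where
      go : ∀ {k l} {p : Vec Carrier k} {q : Vec Carrier l} →
        All B p → All B q → Horner (horner p + horner q)
      go []       q∈ = Horner-resp (sym (+-identityˡ _)) (_ , _ , q∈ , refl)
      go p∈@(_ ∷ _) [] = Horner-resp (sym (+-identityʳ _)) (_ , _ , p∈ , refl)
      go {p = a ∷ p} {b ∷ q} (a∈ ∷ p∈) (b∈ ∷ q∈) = Horner-resp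
        (solve 5 (λ a b s p q → (a ⊕ b) ⊕ s ⊗ (p ⊕ q)
                              := (a ⊕ s ⊗ p) ⊕ (b ⊕ s ⊗ q))
           refl a b s (horner p) (horner q))
        (Horner-∷ (add a∈ b∈) (go p∈ q∈))

    Horner-scale : ∀ {b u} → b ∈ B → Horner u → Horner (b * u)
    Horner-scale {b} b∈ (_ , p , p∈ , u≈p) =
      Horner-resp (sym (*-congˡ u≈p)) (go p∈)
      where
      go : ∀ {k} {p : Vec Carrier k} → All B p → Horner (b * horner p)
      go [] = Horner-resp (sym (zeroʳ b)) Horner-0
      go {p = a ∷ p} (a∈ ∷ p∈) = Horner-resp
        (solve 4 (λ b a s p → b ⊗ a ⊕ s ⊗ (b ⊗ p) := b ⊗ (a ⊕ s ⊗ p))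
           refl b a s (horner p))
        (Horner-∷ (mul b∈ a∈) (go p∈))

    Horner-* : ∀ {u v} → Horner u → Horner v → Horner (u * v)
    Horner-* {v = v} (_ , p , p∈ , u≈p) v∈ =
      Horner-resp (sym (*-congʳ u≈p)) (go p∈)
      where
      go : ∀ {k} {p : Vec Carrier k} → All B p → Horner (horner p * v)
      go [] = Horner-resp (sym (zeroˡ v)) Horner-0
      go {p = a ∷ p} (a∈ ∷ p∈) = Horner-resp
        (solve 4 (λ v a s p → a ⊗ v ⊕ s ⊗ (p ⊗ v) := (a ⊕ s ⊗ p) ⊗ v)
           refl v a s (horner p))
        (Horner-+ (Horner-scale a∈ v∈) (Horner-s* (go p∈)))

    adjoin-slice⇒Horner : ∀ {u} → u ∈ adjoin R B ｛ s ｝ → Horner u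
    adjoin-slice⇒Horner (base u∈B)  = Horner-base u∈B
    adjoin-slice⇒Horner (gen ≡.refl) =
      Horner-resp (*-identityʳ s) (Horner-s* (Horner-base one))
    adjoin-slice⇒Horner one         = Horner-base one
    adjoin-slice⇒Horner (add u v)   =
      Horner-+ (adjoin-slice⇒Horner u) (adjoin-slice⇒Horner v)
    adjoin-slice⇒Horner (mul u v)   =
      Horner-* (adjoin-slice⇒Horner u) (adjoin-slice⇒Horner v)
    adjoin-slice⇒Horner (neg u)     = Horner-resp (-1*x≈-x _)
      (Horner-scale (neg one) (adjoin-slice⇒Horner u))
    adjoin-slice⇒Horner (resp u≈v u) = Horner-resp u≈v (adjoin-slice⇒Horner u)

    -- Write u = b + s h with coefficients in B. The coefficients of D u are positive multiples of
    -- those of h; as D u = 0, all of them vanish and u = b.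
    constant∈base : ∀ {u} → u ∈ adjoin R B ｛ s ｝ → D u ≈ 0# → u ∈ B
    constant∈base u∈ Du≈0 with adjoin-slice⇒Horner u∈
    ... | _ , []    , []        , u≈0 = resp (sym u≈0) zero∈adjoin
    ... | _ , b ∷ p , b∈ ∷ p∈ , u≈bp = resp b≈u b∈
      where
      constants : ∀ {k} {p : Vec Carrier k} → All B p → Constants p
      constants []        = []
      constants (b∈ ∷ p∈) = constant b∈ ∷ constants p∈
      p≈0 : horner p ≈ 0#
      p≈0 = horner-zeros (D-horner-zeros (constant b∈) (constants p∈)
        (trans (D-cong (sym u≈bp)) Du≈0))
      b≈u : b ≈ _
      b≈u = trans (sym (trans (+-congˡ (trans (*-congˡ p≈0) (zeroʳ s))) (+-identityʳ b)))
                  (sym u≈bp)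

-- Extension of a derivation to fractions with constant denominators.

module FractionDerivation {c ℓ} (R : CommutativeRing c ℓ)
    {D : CommutativeRing.Carrier R → CommutativeRing.Carrier R}
    (isD : IsDerivationOn R D) {s : CommutativeRing.Carrier R}
    (Ds≈0 : CommutativeRing._≈_ R (D s) (CommutativeRing.0# R)) where

  open CommutativeRing R hiding (zero)
  open IsDerivationOn isD
  open DerivationProperties R isD
  open Localisation R s using (Frac; _/s^_; mk≃; localisation)
  open Exp semiring using (_^_; ^-homo-*)
  open SetoidReasoning setoid
  open SemiringSolver commutativeSemiring
    using (solve; _:=_) renaming (_:+_ to _⊕_; _:*_ to _⊗_)

  -- Since D s = 0, the quotient rule reduces to differentiating the numerator.
  D/ : Frac → Frac
  D/ (a /s^ k) = D a /s^ k

  private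
    D-s^ : ∀ k → D (s ^ k) ≈ 0#
    D-s^ = D-constant-^ Ds≈0

  D/-isDerivationOn : IsDerivationOn localisation D/
  D/-isDerivationOn = record
    -- Apply D to the cross-multiplied equation: powers of `s` are constants and move out of D.
    { D-cong = λ { {a /s^ k} {b /s^ l} (mk≃ m p) → mk≃ m (begin
        s ^ m * (D a * s ^ l)    ≈⟨ pull m a l ⟨
        D (s ^ m * (a * s ^ l))  ≈⟨ D-cong p ⟩
        D (s ^ m * (b * s ^ k))  ≈⟨ pull m b k ⟩
        s ^ m * (D b * s ^ k)    ∎) }
    ; D-+ = λ { (a /s^ k) (b /s^ l) → mk≃ 0 (*-congˡ (*-congʳ
        (trans (D-+ _ _)
               (+-cong (D-constantʳ a (D-s^ l)) (D-constantʳ b (D-s^ k)))))) }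
    -- Addition of fractions multiplies the two equal denominators, so the right-hand side has twice
    -- the exponent of the left-hand one.
    ; D-* = λ { (a /s^ k) (b /s^ l) → mk≃ 0 (*-congˡ (begin
        D (a * b) * s ^ (k ℕ.+ l ℕ.+ (k ℕ.+ l))
          ≈⟨ *-cong (D-* a b) (^-homo-* s (k ℕ.+ l) (k ℕ.+ l)) ⟩
        (D a * b + a * D b) * (s ^ (k ℕ.+ l) * s ^ (k ℕ.+ l))
          ≈⟨ solve 3 (λ x y t → (x ⊕ y) ⊗ (t ⊗ t) := (x ⊗ t ⊕ y ⊗ t) ⊗ t)
               refl (D a * b) (a * D b) (s ^ (k ℕ.+ l)) ⟩
        (D a * b * s ^ (k ℕ.+ l) + a * D b * s ^ (k ℕ.+ l)) * s ^ (k ℕ.+ l) ∎)) }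
    }
    where
    pull : ∀ m a l → D (s ^ m * (a * s ^ l)) ≈ s ^ m * (D a * s ^ l)
    pull m a l = trans (D-constantˡ _ (D-s^ m)) (*-congˡ (D-constantʳ a (D-s^ l)))

-- Rational identities and reciprocal factorials.

a/1*1/ab≡1/b : ∀ a b d .{{_ : ℕ.NonZero a}} .{{_ : ℕ.NonZero b}} .{{_ : ℕ.NonZero d}} →
  d ≡ a ℕ.* b → (ℤ.+ a ℚ./ 1) ℚ.* (ℤ.1ℤ ℚ./ d) ≡ ℤ.1ℤ ℚ./ b
a/1*1/ab≡1/b (suc a) (suc b) _ ≡.refl = ℚ.toℚᵘ-injective (begin
  ℚ.toℚᵘ ((ℤ.+ suc a ℚ./ 1) ℚ.* (ℤ.1ℤ ℚ./ (suc a ℕ.* suc b)))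
    ≈⟨ ℚ.toℚᵘ-homo-* (ℤ.+ suc a ℚ./ 1) (ℤ.1ℤ ℚ./ (suc a ℕ.* suc b)) ⟩
  ℚ.toℚᵘ (ℤ.+ suc a ℚ./ 1) ℚᵘ.* ℚ.toℚᵘ (ℤ.1ℤ ℚ./ (suc a ℕ.* suc b))
    ≈⟨ ℚᵘ.*-cong (ℚ.toℚᵘ-fromℚᵘ (ℤ.+ suc a ℚᵘ./ 1))
                 (ℚ.toℚᵘ-fromℚᵘ (ℤ.1ℤ ℚᵘ./ (suc a ℕ.* suc b))) ⟩
  (ℤ.+ suc a ℚᵘ./ 1) ℚᵘ.* (ℤ.1ℤ ℚᵘ./ (suc a ℕ.* suc b))
    ≈⟨ ℚᵘ.*≡* (≡.cong ℤ.+_ (nat a b)) ⟩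
  ℤ.1ℤ ℚᵘ./ suc b
    ≈⟨ ℚ.toℚᵘ-fromℚᵘ (ℤ.1ℤ ℚᵘ./ suc b) ⟨
  ℚ.toℚᵘ (ℤ.1ℤ ℚ./ suc b) ∎)
  where
  open SetoidReasoning ℚᵘ.≃-setoid
  nat : ∀ a b → suc a ℕ.* 1 ℕ.* suc b ≡ 1 ℕ.* (1 ℕ.* (suc a ℕ.* suc b))
  nat a b = ≡.trans (≡.cong (ℕ._* suc b) (ℕ.*-identityʳ (suc a)))
    (≡.sym (≡.trans (ℕ.*-identityˡ _) (ℕ.*-identityˡ _)))

[1+a]/1≡1+a/1 : ∀ a → ℤ.+ suc a ℚ./ 1 ≡ 1ℚ ℚ.+ (ℤ.+ a ℚ./ 1)
[1+a]/1≡1+a/1 a = ℚ.toℚᵘ-injective (begin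
  ℚ.toℚᵘ (ℤ.+ suc a ℚ./ 1)
    ≈⟨ ℚ.toℚᵘ-fromℚᵘ (ℤ.+ suc a ℚᵘ./ 1) ⟩
  ℤ.+ suc a ℚᵘ./ 1
    ≈⟨ ℚᵘ.*≡* (≡.cong (λ z → (ℤ.1ℤ ℤ.+ z) ℤ.* ℤ.1ℤ) (≡.sym (ℤ.*-identityʳ (ℤ.+ a)))) ⟩
  ℚᵘ.1ℚᵘ ℚᵘ.+ (ℤ.+ a ℚᵘ./ 1)
    ≈⟨ ℚᵘ.+-congʳ ℚᵘ.1ℚᵘ (ℚ.toℚᵘ-fromℚᵘ (ℤ.+ a ℚᵘ./ 1)) ⟨
  ℚᵘ.1ℚᵘ ℚᵘ.+ ℚ.toℚᵘ (ℤ.+ a ℚ./ 1)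
    ≈⟨ ℚ.toℚᵘ-homo-+ 1ℚ (ℤ.+ a ℚ./ 1) ⟨
  ℚ.toℚᵘ (1ℚ ℚ.+ (ℤ.+ a ℚ./ 1)) ∎)
  where open SetoidReasoning ℚᵘ.≃-setoid

-- `iterate` unfolds by changing the starting value, while differentiating a term of the series puts
-- the new application outside.
iterate-suc : ∀ {a} {A : Set a} (f : A → A) x k → iterate f x (suc k) ≡ f (iterate f x k)
iterate-suc f x zero    = ≡.refl
iterate-suc f x (suc k) = iterate-suc f (f x) k

-- Unfolds to the same term as `1/!_` but does not depend on n; hence `σx` is by definition a sum of
-- multiples of `dividedPower`.
reciprocal! : ℕ → ℚ
reciprocal! k = (ℤ.1ℤ ℚ./ (k !)) {{k ℕ.!≢0}}

reciprocal!-suc : ∀ k → (ℤ.+ suc k ℚ./ 1) ℚ.* reciprocal! (suc k) ≡ reciprocal! k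
reciprocal!-suc k = a/1*1/ab≡1/b (suc k) (k !) (suc k !) {{_}} {{k ℕ.!≢0}} {{suc k ℕ.!≢0}} ≡.refl

-- Rational scalars, divided powers and the exponential series.

module ℚ-Algebra {c ℓ} (R : CommutativeRing c ℓ)
    {const : ℚ → CommutativeRing.Carrier R}
    (const-hom : RingMorphisms.IsRingHomomorphism
                   ℚ.+-*-rawRing (CommutativeRing.rawRing R) const) where

  open CommutativeRing R hiding (zero)
  open Mult semiring renaming (_×_ to _·_)
  open Exp semiring using (_^_)
  open Sum semiring using (sum; sum-cong-≋)
  open RingProperties ring using (-‿distribʳ-*)
  open GroupProperties +-group using (ε⁻¹≈ε)
  open SetoidReasoning setoid
  open SemiringSolver commutativeSemiring
    using (solve; _:=_) renaming (_:+_ to _⊕_; _:*_ to _⊗_)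

  private module const = RingMorphisms.IsRingHomomorphism const-hom

  const-inverse : ∀ k .{{_ : ℕ.NonZero k}} →
    const (ℤ.+ k ℚ./ 1) * const (ℤ.1ℤ ℚ./ k) ≈ 1#
  const-inverse k = trans (sym (const.*-homo _ _)) (trans
    (const.⟦⟧-cong (a/1*1/ab≡1/b k 1 k (≡.sym (ℕ.*-identityʳ k)))) const.1#-homo)

  -- Turns the repeated addition produced by the power rule `D-^` into a rational scalar, which can
  -- cancel against a factorial.
  const-· : ∀ k u → const (ℤ.+ k ℚ./ 1) * u ≈ k · u
  const-· zero    u = trans (*-congʳ const.0#-homo) (zeroˡ u)
  const-· (suc k) u = begin
    const (ℤ.+ suc k ℚ./ 1) * u
      ≈⟨ *-congʳ (const.⟦⟧-cong ([1+a]/1≡1+a/1 k)) ⟩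
    const (1ℚ ℚ.+ (ℤ.+ k ℚ./ 1)) * u
      ≈⟨ *-congʳ (trans (const.+-homo _ _) (+-congʳ const.1#-homo)) ⟩
    (1# + const (ℤ.+ k ℚ./ 1)) * u
      ≈⟨ distribʳ u _ _ ⟩
    1# * u + const (ℤ.+ k ℚ./ 1) * u
      ≈⟨ +-cong (*-identityˡ u) (const-· k u) ⟩
    u + k · u ∎

  torsion-free : TorsionFree R
  torsion-free k {u} ku≈0 = begin
    u                        ≈⟨ *-identityˡ u ⟨
    1# * u                   ≈⟨ *-congʳ (const-inverse (suc k)) ⟨
    const (ℤ.+ suc k ℚ./ 1) * const (ℤ.1ℤ ℚ./ suc k) * u
      ≈⟨ solve 3 (λ a b u → a ⊗ b ⊗ u := b ⊗ (a ⊗ u)) refl _ _ u ⟩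
    const (ℤ.1ℤ ℚ./ suc k) * (const (ℤ.+ suc k ℚ./ 1) * u)
      ≈⟨ *-congˡ (trans (const-· (suc k) u) ku≈0) ⟩
    const (ℤ.1ℤ ℚ./ suc k) * 0# ≈⟨ zeroʳ _ ⟩
    0#                       ∎

  -- Undoes the normalisation of a Cayley element: `k` will be m (m-2)!, `x` will be x₀^(m-1), and
  -- `u` will be σ(x_m).
  cancel-scaling : ∀ k .{{_ : ℕ.NonZero k}} {x y} u → x * y ≈ 1# →
    const (ℤ.1ℤ ℚ./ k) * y * (const (ℤ.+ k ℚ./ 1) * x * u) ≈ u
  cancel-scaling k {x} {y} u xy≈1 = begin
    const (ℤ.1ℤ ℚ./ k) * y * (const (ℤ.+ k ℚ./ 1) * x * u)
      ≈⟨ solve 5 (λ a b c d u → a ⊗ b ⊗ (c ⊗ d ⊗ u) := (c ⊗ a) ⊗ (d ⊗ b) ⊗ u) refl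
           (const (ℤ.1ℤ ℚ./ k)) y (const (ℤ.+ k ℚ./ 1)) x u ⟩
    const (ℤ.+ k ℚ./ 1) * const (ℤ.1ℤ ℚ./ k) * (x * y) * u
      ≈⟨ *-congʳ (*-cong (const-inverse k) xy≈1) ⟩
    1# * 1# * u
      ≈⟨ trans (*-congʳ (*-identityˡ 1#)) (*-identityˡ u) ⟩
    u ∎

  dividedPower : Carrier → ℕ → Carrier
  dividedPower l k = const (reciprocal! k) * l ^ k

  module _ {D : Carrier → Carrier} (isD : IsDerivationOn R D)
           (D-const : ∀ q → D (const q) ≈ 0#)
           {l : Carrier} (Dl≈-1 : D l ≈ - 1#) where

    open IsDerivationOn isD
    open DerivationProperties R isD

    D-dividedPower : ∀ k → D (dividedPower l (suc k)) ≈ - dividedPower l k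
    D-dividedPower k = begin
      D (const (reciprocal! (suc k)) * l ^ suc k)
        ≈⟨ D-constantˡ _ (D-const _) ⟩
      const (reciprocal! (suc k)) * D (l ^ suc k)
        ≈⟨ *-congˡ (D-^ l k) ⟩
      const (reciprocal! (suc k)) * (suc k · (l ^ k * D l))
        ≈⟨ *-congˡ (trans (sym (const-· (suc k) _)) (*-congˡ (*-congˡ Dl≈-1))) ⟩
      const (reciprocal! (suc k)) * (const (ℤ.+ suc k ℚ./ 1) * (l ^ k * - 1#))
        ≈⟨ solve 4 (λ a b c d → a ⊗ (b ⊗ (c ⊗ d)) := (b ⊗ a ⊗ c) ⊗ d) refl
             (const (reciprocal! (suc k))) (const (ℤ.+ suc k ℚ./ 1)) (l ^ k) (- 1#) ⟩
      const (ℤ.+ suc k ℚ./ 1) * const (reciprocal! (suc k)) * l ^ k * - 1#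
        ≈⟨ *-congʳ (*-congʳ (trans (sym (const.*-homo _ _)) (const.⟦⟧-cong (reciprocal!-suc k)))) ⟩
      dividedPower l k * - 1#
        ≈⟨ trans (sym (-‿distribʳ-* _ 1#)) (-‿cong (*-identityʳ _)) ⟩
      - dividedPower l k ∎

    -- By the Leibniz rule, the k-th term has derivative u_(k+1) l^k/k! - u_k l^(k-1)/(k-1)!. The
    -- sum telescopes, and its last term contains the factor u_(N+1) = 0.
    D-series≈0 : (u : ℕ → Carrier) → (∀ k → D (u k) ≈ u (suc k)) →
      ∀ N → u (suc N) ≈ 0# → D (sum {suc N} λ k → u (toℕ k) * dividedPower l (toℕ k)) ≈ 0#
    D-series≈0 u Du N uN≈0 = begin
      D (sum {suc N} λ k → u (toℕ k) * dividedPower l (toℕ k))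
        ≈⟨ D-sum {suc N} (λ k → u (toℕ k) * dividedPower l (toℕ k)) ⟩
      sum {suc N} (λ k → D (u (toℕ k) * dividedPower l (toℕ k)))
        ≈⟨ sum-cong-≋ {suc N} (λ k → D-term (toℕ k)) ⟩
      sum {suc N} (λ k → a (suc (toℕ k)) - a (toℕ k))
        ≈⟨ telescope R a (suc N) ⟩
      u (suc N) * dividedPower l N - 0#
        ≈⟨ +-cong (trans (*-congʳ uN≈0) (zeroˡ _)) ε⁻¹≈ε ⟩
      0# + 0#
        ≈⟨ +-identityˡ 0# ⟩
      0# ∎
      where
      a : ℕ → Carrier
      -- `a k` stands for u_k l^(k-1)/(k-1)!; its value at 0 is 0 because l^0/0! is constant.
      a zero    = 0#
      a (suc k) = u (suc k) * dividedPower l k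
      u*D-dividedPower : ∀ k → u k * D (dividedPower l k) ≈ - a k
      u*D-dividedPower zero    = trans
        (*-congˡ (D-constant-* (D-const _) D-1)) (trans (zeroʳ _) (sym ε⁻¹≈ε))
      u*D-dividedPower (suc k) =
        trans (*-congˡ (D-dividedPower k)) (sym (-‿distribʳ-* _ _))
      D-term : ∀ k → D (u k * dividedPower l k) ≈ a (suc k) - a k
      D-term k = trans (D-* _ _) (+-cong (*-congʳ (Du k)) (u*D-dividedPower k))

-- The Kravchuk derivation on the localisation and its constants.

derivation-isDerivationOn : ∀ {N} (d : Fin N → Poly N) →
  IsDerivationOn (polyRing N) (derivation d)
derivation-isDerivationOn d = record { D-cong = D.cong ; D-+ = D.+-homo ; D-* = D.leibniz }
  where module D = IsDerivation (derivation-isDerivation d)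

module _ (n : ℕ) (2≤n : 2 ≤ n) where

  open Kravchuk n 2≤n

  private
    module P = CommutativeRing (polyRing (suc n))
    module PExp = Exp P.semiring
    module PSum = Sum P.semiring

  open CommutativeRing localisation hiding (zero)
  open Exp semiring using (_^_)
  open Sum semiring using (sum)
  open GroupProperties +-group using (//-rightDividesʳ)
  open SetoidReasoning setoid
  open SemiringSolver commutativeSemiring using (solve; _:=_)
    renaming (_:+_ to _⊕_; _:*_ to _⊗_)

  open FractionDerivation (polyRing (suc n)) (derivation-isDerivationOn 𝒟x) {x₀} P.refl
    renaming (D/ to 𝒟/)
  open IsDerivationOn D/-isDerivationOn
  open DerivationProperties localisation D/-isDerivationOn

  open Localisation (polyRing (suc n)) x₀ using (ι-isRingHomomorphism; ιs*s⁻¹≃1)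

  ι-cong : ∀ {f g} → f P.≈ g → ι f ≈ ι g
  ι-cong p = mk≃ 0 (P.*-congˡ (P.*-congʳ p))

  ι-+ : ∀ f g → ι (f :+ g) ≈ ι f + ι g
  ι-+ f g = ι-cong (P.+-cong (P.sym (P.*-identityʳ f)) (P.sym (P.*-identityʳ g)))

  const : ℚ → Frac
  const q = ι (con q)

  const-isRingHomomorphism : RingMorphisms.IsRingHomomorphism ℚ.+-*-rawRing rawRing const
  const-isRingHomomorphism =
    isRingHomomorphism trans con-isRingHomomorphism ι-isRingHomomorphism

  open ℚ-Algebra localisation const-isRingHomomorphism
    using (torsion-free; cancel-scaling; dividedPower; D-series≈0)

  s : Frac
  s = ι x₁ * x₀⁻¹

  ιx₀*s≈ιx₁ : ι x₀ * s ≈ ι x₁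
  ιx₀*s≈ιx₁ = begin
    ι x₀ * (ι x₁ * x₀⁻¹)
      ≈⟨ solve 3 (λ a b c → a ⊗ (b ⊗ c) := b ⊗ (a ⊗ c)) refl (ι x₀) (ι x₁) x₀⁻¹ ⟩
    ι x₁ * (ι x₀ * x₀⁻¹)  ≈⟨ *-congˡ ιs*s⁻¹≃1 ⟩
    ι x₁ * 1#             ≈⟨ *-identityʳ _ ⟩
    ι x₁                  ∎

  𝒟/-x₀⁻¹ : 𝒟/ x₀⁻¹ ≈ 0#
  𝒟/-x₀⁻¹ = mk≃ 0 (P.*-congˡ (P.trans (P.zeroˡ _) (P.sym (P.zeroˡ _))))

  𝒟/-s : 𝒟/ s ≈ 1#
  𝒟/-s = trans (D-constantʳ (ι x₁) 𝒟/-x₀⁻¹)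
    (trans (*-congʳ (ι-cong (𝒟x₁≈x₀ n 2≤n))) ιs*s⁻¹≃1)
    where
    -- Stated for every n so that n can be split; then the index of x₁ and the one-term sum reduce,
    -- with leading coefficient (1-(-1))/2 = 1.
    𝒟x₁≈x₀ : ∀ n 2≤n → let module K = Kravchuk n 2≤n in
      CommutativeRing._≈_ (polyRing (suc n)) (K.𝒟 K.x₁) K.x₀
    𝒟x₁≈x₀ (suc (suc n)) (s≤s (s≤s _)) =
      trans′ (+-identityʳ′ _) (*-identityˡ′ _)
      where
      open CommutativeRing (polyRing (suc (suc (suc n)))) using ()
        renaming (trans to trans′; +-identityʳ to +-identityʳ′; *-identityˡ to *-identityˡ′)

  -- The telescoping series with u_k = 𝒟^k(x_m); its leftover term vanishes because m + 1
  -- applications of 𝒟 kill x_m.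
  𝒟/-σx : ∀ m → 𝒟/ (σx m) ≈ 0#
  𝒟/-σx m = D-series≈0 D/-isDerivationOn (λ _ → refl {0#})
    -- `-x₁/x₀` unfolds to `- s`, so its derivative is -1.
    {l = -x₁/x₀} (trans (D-neg s) (-‿cong 𝒟/-s))
    (λ k → ι (iterate 𝒟 (var m) k))
    (λ k → reflexive (≡.cong ι (≡.sym (iterate-suc 𝒟 (var m) k))))
    (toℕ m) (ι-cong (𝒟^k[x_m]≈0 (suc (toℕ m)) m (ℕ.n<1+n _)))

  private
    B : Pred Frac _
    B = ℚ[x₀,C₂,…,Cₙ][x₀⁻¹]

  -- One use of `adjoin-constant` for each of the two adjunctions. C_m is constant as a product of a
  -- rational number, a power of x₀ and σ(x_m).
  B-constant : ∀ {u} → u ∈ B → 𝒟/ u ≈ 0#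
  B-constant = adjoin-constant
    (adjoin-constant (λ { (q , _ , u≈q) → D-cong u≈q })
      (λ { (inj₁ ≡.refl) → refl ; (inj₂ (m , _ , ≡.refl)) → 𝒟/-C m }))
    (λ { ≡.refl → 𝒟/-x₀⁻¹ })
    where
    𝒟/-ιx₀^ : ∀ k → 𝒟/ (ι (x₀ PExp.^ k)) ≈ 0#
    𝒟/-ιx₀^ zero    = refl
    𝒟/-ιx₀^ (suc k) = D-constant-* {ι x₀} refl (𝒟/-ιx₀^ k)
    𝒟/-C : ∀ m → 𝒟/ (C m) ≈ 0#
    𝒟/-C m = D-constant-*
      (D-constant-* {const (ℤ.+ (toℕ m ℕ.* (toℕ m ∸ 2) !) ℚ./ 1)} refl (𝒟/-ιx₀^ (toℕ m ∸ 1)))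
      (𝒟/-σx m)

  const∈B : ∀ q → const q ∈ B
  const∈B q = base (base (q , _ , refl))

  ιx₀∈B : ι x₀ ∈ B
  ιx₀∈B = base (gen (inj₁ ≡.refl))

  ι-^ : ∀ f k → ι (f PExp.^ k) ≡ ι f ^ k
  ι-^ f zero    = ≡.refl
  ι-^ f (suc k) = ≡.cong (ι f *_) (ι-^ f k)

  -- The factor m (m-2)! x₀^(m-1) of C_m is invertible in B, so dividing by it recovers σ(x_m).
  σx∈B : ∀ m → 2 ≤ toℕ m → σx m ∈ B
  σx∈B m 2≤m = resp
    (cancel-scaling N {ι (x₀ PExp.^ e)} {x₀⁻¹ ^ e} (σx m)
      (≡.subst (λ x → x * x₀⁻¹ ^ e ≈ 1#) (≡.sym (ι-^ x₀ e))
        (^-inverse localisation {ι x₀} {x₀⁻¹} ιs*s⁻¹≃1 e)))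
    (mul (mul (const∈B _) (^∈adjoin (gen ≡.refl) e))
         (base (gen (inj₂ (m , 2≤m , ≡.refl)))))
    where
    open AdjoinProperties localisation
    e N : ℕ
    e = toℕ m ∸ 1
    N = toℕ m ℕ.* (toℕ m ∸ 2) !
    instance
      N≢0 : ℕ.NonZero N
      N≢0 = ℕ.m*n≢0 _ _ {{ℕ.>-nonZero (ℕ.≤-trans (s≤s ℕ.z≤n) 2≤m)}} {{(toℕ m ∸ 2) ℕ.!≢0}}

  -- Triangularity, and generation of the polynomials by the slice over B.

  data VarsBelow (m : ℕ) : ℚ[x] → Set where
    con  : ∀ q → VarsBelow m (con q)
    var  : ∀ {i} → toℕ i ℕ.< m → VarsBelow m (var i)
    _:+_ : ∀ {f g} → VarsBelow m f → VarsBelow m g → VarsBelow m (f :+ g)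
    _:*_ : ∀ {f g} → VarsBelow m f → VarsBelow m g → VarsBelow m (f :* g)

  sum-varsBelow : ∀ {m k} (t : Fin k → ℚ[x]) → (∀ j → VarsBelow m (t j)) →
    VarsBelow m (PSum.sum t)
  sum-varsBelow {k = zero}  t t< = con _
  sum-varsBelow {k = suc k} t t< = t< zero :+ sum-varsBelow _ (λ j → t< (suc j))

  -- The bound is i ≤ m rather than i < m since 𝒟(x_i) only involves variables strictly before x_i;
  -- the induction in `var∈B[s]` uses m = i.
  𝒟x-varsBelow : ∀ {m} i → toℕ i ≤ m → VarsBelow m (𝒟x i)
  𝒟x-varsBelow {m} i i≤m = sum-varsBelow _ λ j → con _ :* var
    (≡.subst (ℕ._< m) (≡.sym (toℕ-inject {i = i} (opposite j)))
      (ℕ.<-≤-trans (toℕ<n (opposite j)) i≤m))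

  -- `VarsBelow` is a condition on expressions, not on classes modulo `_≈_`. This works because 𝒟 is
  -- itself computed by recursion on expressions.
  𝒟-varsBelow : ∀ {m f} → VarsBelow m f → VarsBelow m (𝒟 f)
  𝒟-varsBelow (con q)       = con _
  𝒟-varsBelow (var {i} i<m) = 𝒟x-varsBelow i (ℕ.<⇒≤ i<m)
  𝒟-varsBelow (f :+ g)      = 𝒟-varsBelow f :+ 𝒟-varsBelow g
  𝒟-varsBelow (f :* g)      = (𝒟-varsBelow f :* g) :+ (f :* 𝒟-varsBelow g)

  iterate-𝒟-varsBelow : ∀ {m f} k → VarsBelow m f → VarsBelow m (iterate 𝒟 f k)
  iterate-𝒟-varsBelow zero    f = f
  iterate-𝒟-varsBelow (suc k) f = iterate-𝒟-varsBelow k (𝒟-varsBelow f)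

  private
    B[s] : Pred Frac _
    B[s] = adjoin localisation B ｛ s ｝

  varsBelow∈B[s] : ∀ {m} → (∀ i → toℕ i ℕ.< m → ι (var i) ∈ B[s]) →
    ∀ {f} → VarsBelow m f → ι f ∈ B[s]
  varsBelow∈B[s] vars (con q)       = base (const∈B q)
  varsBelow∈B[s] vars (var {i} i<m) = vars i i<m
  varsBelow∈B[s] vars (f :+ g)      = resp (sym (ι-+ _ _))
    (add (varsBelow∈B[s] vars f) (varsBelow∈B[s] vars g))
  varsBelow∈B[s] vars (f :* g)      =
    mul (varsBelow∈B[s] vars f) (varsBelow∈B[s] vars g)

  -- Strong induction on the index: x₀ lies in B, x₁ = x₀ s, and each later variable is obtained by
  -- solving the series σ(x_i) for its leading term.
  var∈B[s] : ∀ i → ι (var i) ∈ B[s]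
  var∈B[s] i = <-rec (λ m → ∀ i → toℕ i ≡ m → ι (var i) ∈ B[s]) step (toℕ i) i ≡.refl
    where
    step : ∀ m → (∀ {l} → l ℕ.< m → ∀ i → toℕ i ≡ l → ι (var i) ∈ B[s]) →
      ∀ i → toℕ i ≡ m → ι (var i) ∈ B[s]
    step 0 _ zero _ = base ιx₀∈B
    step 1 _ i i≡1 = ≡.subst (λ j → ι (var j) ∈ B[s])
      (toℕ-injective (≡.trans (toℕ-fromℕ< (s≤s (ℕ.<⇒≤ 2≤n))) (≡.sym i≡1)))
      (resp ιx₀*s≈ιx₁ (mul (base ιx₀∈B) (gen ≡.refl)))
    -- σ(x_i) - x_i involves only those x_j with j < i.
    step (suc (suc m)) rec i i≡m = resp
      -- `σx i` unfolds to its k = 0 term plus `tail`; that term is x_i because 1/0! computes to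
      -- `1ℚ`.
      (trans (+-congʳ { - tail } {σx i} {ι (var i) + tail} (+-congʳ {tail} head≈))
             (//-rightDividesʳ tail (ι (var i))))
      (add (base (σx∈B i (≡.subst (2 ≤_) (≡.sym i≡m) (s≤s (s≤s ℕ.z≤n)))))
           (neg (sum∈adjoin _ term∈B[s])))
      where
      open AdjoinProperties localisation
      -- The term of σ(x_i) with exponent k + 1; its first application of 𝒟 has already turned
      -- `var i` into `𝒟x i`.
      term : Fin (toℕ i) → Frac
      term k = ι (iterate 𝒟 (𝒟x i) (toℕ k)) * dividedPower -x₁/x₀ (suc (toℕ k))
      tail : Frac
      tail = sum term
      head≈ : ι (var i) * (const 1ℚ * 1#) ≈ ι (var i)
      head≈ = trans (*-congˡ {ι (var i)} (*-identityˡ 1#)) (*-identityʳ _)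
      term∈B[s] : ∀ k → term k ∈ B[s]
      term∈B[s] k = mul
        (varsBelow∈B[s] (λ j j<i → rec (≡.subst (toℕ j ℕ.<_) i≡m j<i) j ≡.refl)
          (iterate-𝒟-varsBelow (toℕ k) (𝒟x-varsBelow i ℕ.≤-refl)))
        (mul (base (const∈B _))
             (^∈adjoin (neg (gen ≡.refl)) (suc (toℕ k))))

  ι∈B[s] : ∀ f → ι f ∈ B[s]
  ι∈B[s] (con q)  = base (const∈B q)
  ι∈B[s] (var i)  = var∈B[s] i
  ι∈B[s] (f :+ g) = resp (sym (ι-+ f g)) (add (ι∈B[s] f) (ι∈B[s] g))
  ι∈B[s] (f :* g) = mul (ι∈B[s] f) (ι∈B[s] g)

  -- The two inclusions.

  open Slice localisation D/-isDerivationOn torsion-free {s} 𝒟/-s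
    using (constant∈base)

  -- Every polynomial lies in B[s], and a constant of B[s] lies in B.
  kernel⊆ : image localisation ι (ker 𝒟) ⊆ B ∩ image localisation ι U
  kernel⊆ (f , 𝒟f≈0 , u≈f) =
    resp (sym u≈f) (constant∈base B-constant (ι∈B[s] f) (ι-cong 𝒟f≈0)) , f , _ , u≈f

  -- Elements of B are constants, and `ι-injective` brings the vanishing of the derivative back to
  -- the polynomial ring.
  kernel⊇ : B ∩ image localisation ι U ⊆ image localisation ι (ker 𝒟)
  kernel⊇ (u∈B , f , _ , u≈f) =
    f , ι-injective (trans (D-cong (sym u≈f)) (B-constant u∈B)) , u≈f

theorem2p3 : (n : ℕ) (2≤n : 2 ≤ n) →
    let open Kravchuk n 2≤n in
    image localisation ι (ker 𝒟)
    ≐ (ℚ[x₀,C₂,…,Cₙ][x₀⁻¹] ∩ image localisation ι U)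
theorem2p3 n 2≤n = kernel⊆ n 2≤n , kernel⊇ n 2≤n
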